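{- For the generalized aztec diamond lattice, the entropy constant $\eta=\lim_{m,n\to\infty} f(m,n)^{1/(2mn+m+n)}$ exists and satisfies $$1.503041110\le \eta\le 1.503048372 .$$
   Context: For positive integers $m,n$ the generalized aztec diamond of order $m\times n$ is the graph with vertices $(x,y)$, $1\le x\le 2m+1$, $1\le y\le 2n+1$, $x+y$ odd, where $(x,y)$ is adjacent to $(x',y')$ iff $|x-x'|=|y-y'|=1$. It has $2mn+m+n$ vertices. $f(m,n)$ is its number of independent sets (the empty set included), and the limit is the double limit with $m,n\to\infty$ independently. -}

module Defs where

open import Algebra.Definitions.RawSemiring using ()
open import Data.Integer.Base using (+_)
open import Data.List.Base using (List; []; _∷_; _++_; map; filter; length; upTo; cartesianProduct)
open import Data.List.Relation.Unary.All using (All; all?)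
open import Data.Nat.Base as ℕ using (ℕ; zero; suc; ∣_-_∣)
import Data.Nat.Properties as ℕ
open import Data.Product using (∃; _×_; _,_)
open import Data.Rational.Base hiding (∣_∣)
open import Data.Rational.Properties
open import Data.Sum.Base using (_⊎_; inj₁; inj₂)
open import Relation.Binary.PropositionalEquality using (_≡_; refl; sym; trans; cong; subst)
open import Relation.Nullary using (¬_; Dec; yes; no)
open import Relation.Nullary.Decidable using (¬?; _×-dec_)
open import Relation.Unary using (Decidable)

open Algebra.Definitions.RawSemiring +-*-rawSemiring public using (_^_)

Vertex : Set
Vertex = ℕ × ℕ

Odd : Vertex → Set
Odd (x , y) = (x ℕ.+ y) ℕ.% 2 ≡ 1

odd? : Decidable Odd
odd? (x , y) = (x ℕ.+ y) ℕ.% 2 ℕ.≟ 1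

Adjacent : Vertex → Vertex → Set
Adjacent (x , y) (x′ , y′) = ∣ x - x′ ∣ ≡ 1 × ∣ y - y′ ∣ ≡ 1

adjacent? : ∀ u v → Dec (Adjacent u v)
adjacent? (x , y) (x′ , y′) = (∣ x - x′ ∣ ℕ.≟ 1) ×-dec (∣ y - y′ ∣ ℕ.≟ 1)

range : ℕ → List ℕ
range k = map suc (upTo k)

aztecVertices : ℕ → ℕ → List Vertex
aztecVertices m n =
  filter odd? (cartesianProduct (range (2 ℕ.* m ℕ.+ 1)) (range (2 ℕ.* n ℕ.+ 1)))

-- For a list without repetitions (such as aztecVertices m n) this lists
-- each subset of its elements exactly once.
subsets : ∀ {A : Set} → List A → List (List A)
subsets []       = [] ∷ []
subsets (x ∷ xs) = subsets xs ++ map (x ∷_) (subsets xs)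

Independent : List Vertex → Set
Independent S = All (λ u → All (λ v → ¬ Adjacent u v) S) S

independent? : Decidable Independent
independent? S = all? (λ u → all? (λ v → ¬? (adjacent? u v)) S) S

f : ℕ → ℕ → ℕ
f m n = length (filter independent? (subsets (aztecVertices m n)))

order : ℕ → ℕ → ℕ
order m n = 2 ℕ.* m ℕ.* n ℕ.+ m ℕ.+ n

order-nonZero : ∀ m n → .{{ℕ.NonZero m}} → ℕ.NonZero (order m n)
order-nonZero (suc m) n = ℕ.>-nonZero
  (ℕ.<-≤-trans (ℕ.s≤s ℕ.z≤n)
    (ℕ.≤-trans (ℕ.m≤n+m (suc m) (2 ℕ.* suc m ℕ.* n)) (ℕ.m≤m+n _ n)))

record ℝ : Set₁ where
  field
    L U         : ℚ → Set
    L-inhabited : ∃ L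
    U-inhabited : ∃ U
    L-down      : ∀ {p q} → p < q → L q → L p
    U-up        : ∀ {p q} → p < q → U p → U q
    L-open      : ∀ {p} → L p → ∃ λ q → p < q × L q
    U-open      : ∀ {q} → U q → ∃ λ p → p < q × U p
    disjoint    : ∀ {q} → L q → ¬ U q
    located     : ∀ {p q} → p < q → L p ⊎ U q

open ℝ

infix 4 _≤ᵣ_ _<ᵣ_

_≤ᵣ_ : ℝ → ℝ → Set
x ≤ᵣ y = ∀ q → L x q → L y q

_<ᵣ_ : ℝ → ℝ → Set
x <ᵣ y = ∃ λ q → U x q × L y q

private
  pred< : ∀ p → p - 1ℚ < p
  pred< p = subst (p - 1ℚ <_) (+-identityʳ p) (+-monoʳ-< p (negative⁻¹ (- 1ℚ)))

  <suc : ∀ p → p < p + 1ℚ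
  <suc p = subst (_< p + 1ℚ) (+-identityʳ p) (+-monoʳ-< p (positive⁻¹ 1ℚ))

fromℚ : ℚ → ℝ
fromℚ a = record
  { L           = _< a
  ; U           = a <_
  ; L-inhabited = a - 1ℚ , pred< a
  ; U-inhabited = a + 1ℚ , <suc a
  ; L-down      = <-trans
  ; U-up        = λ p<q a<p → <-trans a<p p<q
  ; L-open      = <-dense
  ; U-open      = λ a<q → let r , a<r , r<q = <-dense a<q in r , r<q , a<r
  ; disjoint    = <-asym
  ; located     = loc
  }
  where
  loc : ∀ {p q} → p < q → p < a ⊎ a < q
  loc {p} p<q with p <? a
  ... | yes p<a = inj₁ p<a
  ... | no  p≮a = inj₂ (≤-<-trans (≮⇒≥ p≮a) p<q)

private
  cancel : ∀ p e → (p + e) - e ≡ p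
  cancel p e = trans (+-assoc p e (- e))
    (trans (cong (λ z → p + z) (+-inverseʳ e)) (+-identityʳ p))

  cancel′ : ∀ p e → (p - e) + e ≡ p
  cancel′ p e = trans (+-assoc p (- e) e)
    (trans (cong (λ z → p + z) (+-inverseˡ e)) (+-identityʳ p))

infixl 6 _+ᵣ_

_+ᵣ_ : ℝ → ℚ → ℝ
x +ᵣ e = record
  { L           = λ q → L x (q - e)
  ; U           = λ q → U x (q - e)
  ; L-inhabited = let p , Lp = L-inhabited x in p + e , subst (L x) (sym (cancel p e)) Lp
  ; U-inhabited = let p , Up = U-inhabited x in p + e , subst (U x) (sym (cancel p e)) Up
  ; L-down      = λ p<q → L-down x (+-monoˡ-< (- e) p<q)
  ; U-up        = λ p<q → U-up x (+-monoˡ-< (- e) p<q)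
  ; L-open      = λ {p} Lp → let r , p<r , Lr = L-open x Lp in
      r + e , subst (_< r + e) (cancel′ p e) (+-monoˡ-< e p<r) , subst (L x) (sym (cancel r e)) Lr
  ; U-open      = λ {q} Uq → let r , r<q , Ur = U-open x Uq in
      r + e , subst (r + e <_) (cancel′ q e) (+-monoˡ-< e r<q) , subst (U x) (sym (cancel r e)) Ur
  ; disjoint    = disjoint x
  ; located     = λ p<q → located x (+-monoˡ-< (- e) p<q)
  }

-- ∣ x − y ∣ < e
Within : ℚ → ℝ → ℝ → Set
Within e x y = x <ᵣ y +ᵣ e × y <ᵣ x +ᵣ e

private
  ≥0 : ∀ {p} → 0ℚ < p → 0ℚ ≤ p
  ≥0 = <⇒≤

  *-mono-≤ : ∀ {p q r s} → 0ℚ ≤ q → 0ℚ ≤ r → p ≤ q → r ≤ s → p * r ≤ q * s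
  *-mono-≤ {q = q} {r = r} 0≤q 0≤r p≤q r≤s = ≤-trans
    (*-monoʳ-≤-nonNeg r {{nonNegative 0≤r}} p≤q)
    (*-monoˡ-≤-nonNeg q {{nonNegative 0≤q}} r≤s)

  ^-pos : ∀ k {q} → 0ℚ < q → 0ℚ < q ^ k
  ^-pos zero    0<q = positive⁻¹ 1ℚ
  ^-pos (suc k) {q} 0<q = positive⁻¹ (q * q ^ k)
    {{pos*pos⇒pos q {{positive 0<q}} (q ^ k) {{positive (^-pos k 0<q)}}}}

  ^-nonNeg : ∀ k {q} → 0ℚ ≤ q → 0ℚ ≤ q ^ k
  ^-nonNeg zero    0≤q = <⇒≤ (positive⁻¹ 1ℚ)
  ^-nonNeg (suc k) {q} 0≤q = nonNegative⁻¹ (q * q ^ k)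
    {{nonNeg*nonNeg⇒nonNeg q {{nonNegative 0≤q}} (q ^ k) {{nonNegative (^-nonNeg k 0≤q)}}}}

  ^-mono-≤ : ∀ k {p q} → 0ℚ ≤ p → p ≤ q → p ^ k ≤ q ^ k
  ^-mono-≤ zero    0≤p p≤q = ≤-refl
  ^-mono-≤ (suc k) 0≤p p≤q =
    *-mono-≤ (≤-trans 0≤p p≤q) (^-nonNeg k 0≤p) p≤q (^-mono-≤ k 0≤p p≤q)

  ^-mono-< : ∀ k .{{_ : ℕ.NonZero k}} {p q} → 0ℚ ≤ p → p < q → p ^ k < q ^ k
  ^-mono-< (suc k) {p} {q} 0≤p p<q = ≤-<-trans
    (*-monoˡ-≤-nonNeg p {{nonNegative 0≤p}} (^-mono-≤ k 0≤p (<⇒≤ p<q)))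
    (*-monoˡ-<-pos (q ^ k) {{positive (^-pos k (≤-<-trans 0≤p p<q))}} p<q)

  p≤p^k : ∀ k .{{_ : ℕ.NonZero k}} {p} → 1ℚ ≤ p → p ≤ p ^ k
  p≤p^k (suc k) {p} 1≤p = subst (_≤ p * p ^ k) (*-identityʳ p)
    (*-monoˡ-≤-nonNeg p {{nonNegative (≤-trans 0≤1 1≤p)}} (1≤p^ k))
    where
    0≤1 : 0ℚ ≤ 1ℚ
    0≤1 = <⇒≤ (positive⁻¹ 1ℚ)
    1≤p^ : ∀ j → 1ℚ ≤ p ^ j
    1≤p^ zero    = ≤-refl
    1≤p^ (suc j) = subst (_≤ p * p ^ j) (*-identityʳ 1ℚ)
      (*-mono-≤ (≤-trans 0≤1 1≤p) 0≤1 1≤p (1≤p^ j))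

  divide : ∀ a y → 0ℚ < y → ∃ λ c → c * y ≡ a
  divide a y 0<y = a * (1/ y) {{nz}} ,
    trans (*-assoc a _ y) (trans (cong (λ z → a * z) (*-inverseˡ y {{nz}})) (*-identityʳ a))
    where
    nz : NonZero y
    nz = pos⇒nonZero y {{positive 0<y}}

  *-up : ∀ x y a → 0ℚ ≤ y → x * y < a → ∃ λ x′ → x < x′ × x′ * y < a
  *-up x y a 0≤y xy<a with 0ℚ <? y
  ... | no  0≮y = x + 1ℚ , <suc x , subst (_< a) eq xy<a
    where
    y≡0 : y ≡ 0ℚ
    y≡0 = ≤-antisym (≮⇒≥ 0≮y) 0≤y
    eq : x * y ≡ (x + 1ℚ) * y
    eq = trans (cong (λ z → x * z) y≡0) (trans (*-zeroʳ x)
      (sym (trans (cong (λ z → (x + 1ℚ) * z) y≡0) (*-zeroʳ (x + 1ℚ)))))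
  ... | yes 0<y =
    let c , cy≡a = divide a y 0<y
        x′ , x<x′ , x′<c = <-dense (*-cancelʳ-<-nonNeg y {{nonNegative 0≤y}} {x} {c}
                                     (subst (x * y <_) (sym cy≡a) xy<a))
    in x′ , x<x′ , subst (x′ * y <_) cy≡a (*-monoˡ-<-pos y {{positive 0<y}} x′<c)

  *-down : ∀ x y a → 0ℚ ≤ a → 0ℚ < y → a < x * y →
           ∃ λ x′ → 0ℚ < x′ × x′ < x × a < x′ * y
  *-down x y a 0≤a 0<y a<xy =
    let c , cy≡a = divide a y 0<y
        nn = nonNegative (≥0 0<y)
        x′ , c<x′ , x′<x = <-dense (*-cancelʳ-<-nonNeg y {{nn}} {c} {x}
                                     (subst (_< x * y) (sym cy≡a) a<xy))
        a<x′y = subst (_< x′ * y) cy≡a (*-monoˡ-<-pos y {{positive 0<y}} c<x′)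
        0<x′ = *-cancelʳ-<-nonNeg y {{nn}} {0ℚ} {x′}
                 (subst (_< x′ * y) (sym (*-zeroˡ y)) (≤-<-trans 0≤a a<x′y))
    in x′ , 0<x′ , x′<x , a<x′y

  ^-up : ∀ k q a → 0ℚ ≤ q → q ^ k < a → ∃ λ r → q < r × r ^ k < a
  ^-up zero    q a 0≤q 1<a = q + 1ℚ , <suc q , 1<a
  ^-up (suc k) q a 0≤q q^<a =
    let y , q^k<y , yq<a = *-up (q ^ k) q a 0≤q (subst (_< a) (*-comm q (q ^ k)) q^<a)
        0≤y = ≤-trans (^-nonNeg k 0≤q) (<⇒≤ q^k<y)
        r , q<r , r^k<y = ^-up k q y 0≤q q^k<y
        x , q<x , xy<a = *-up q y a 0≤y (subst (_< a) (*-comm y q) yq<a)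
        q<s = q<⊓ q<r q<x
        0≤s = ≤-trans 0≤q (<⇒≤ q<s)
    in r ⊓ x , q<s , ≤-<-trans
         (*-mono-≤ (≤-trans 0≤q (<⇒≤ q<x)) (^-nonNeg k 0≤s) (p⊓q≤q r x)
           (≤-trans (^-mono-≤ k 0≤s (p⊓q≤p r x)) (<⇒≤ r^k<y)))
         xy<a
    where
    q<⊓ : ∀ {r x} → q < r → q < x → q < r ⊓ x
    q<⊓ {r} {x} q<r q<x with ≤-total r x
    ... | inj₁ r≤x = subst (q <_) (sym (p≤q⇒p⊓q≡p r≤x)) q<r
    ... | inj₂ x≤r = subst (q <_) (sym (p≥q⇒p⊓q≡q x≤r)) q<x

  ^-down : ∀ k q a → 0ℚ < q → 0ℚ ≤ a → a < q ^ k → ∃ λ r → 0ℚ < r × r < q × a < r ^ k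
  ^-down zero    q a 0<q 0≤a a<1 = let r , 0<r , r<q = <-dense 0<q in r , 0<r , r<q , a<1
  ^-down (suc k) q a 0<q 0≤a a<q^ =
    let y , 0<y , y<q^k , a<yq = *-down (q ^ k) q a 0≤a 0<q (subst (a <_) (*-comm q (q ^ k)) a<q^)
        r , 0<r , r<q , y<r^k = ^-down k q y 0<q (≥0 0<y) y<q^k
        x , 0<x , x<q , a<xy = *-down q y a 0≤a 0<y (subst (a <_) (*-comm y q) a<yq)
        0<s = <-≤-trans 0<r (p≤p⊔q r x)
    in r ⊔ x , 0<s , ⊔<q r<q x<q , <-≤-trans a<xy
         (*-mono-≤ (≥0 0<s) (≥0 0<y) (p≤q⊔p r x)
           (≤-trans (<⇒≤ y<r^k) (^-mono-≤ k (≥0 0<r) (p≤p⊔q r x))))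
    where
    ⊔<q : ∀ {r x} → r < q → x < q → r ⊔ x < q
    ⊔<q {r} {x} r<q x<q with ≤-total r x
    ... | inj₁ r≤x = subst (_< q) (sym (p≤q⇒p⊔q≡q r≤x)) x<q
    ... | inj₂ x≤r = subst (_< q) (sym (p≥q⇒p⊔q≡p x≤r)) r<q

fromℕ : ℕ → ℚ
fromℕ a = + a / 1

-- The nonnegative root: the disjunct q < 0 is needed for even k, where q ^ k
-- alone would exclude negative q of large absolute value from the lower cut.
root : (k : ℕ) .{{_ : ℕ.NonZero k}} → ℕ → ℝ
root k a = record
  { L           = Lo
  ; U           = Up
  ; L-inhabited = - 1ℚ , inj₁ (negative⁻¹ (- 1ℚ))
  ; U-inhabited = A + 1ℚ , ≤-<-trans 0≤A (<suc A) ,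
      <-≤-trans (<suc A) (p≤p^k k (subst (_≤ A + 1ℚ) (+-identityˡ 1ℚ) (+-monoˡ-≤ 1ℚ 0≤A)))
  ; L-down      = down
  ; U-up        = λ p<q (0<p , A<p^k) → <-trans 0<p p<q ,
      <-≤-trans A<p^k (^-mono-≤ k (≥0 0<p) (<⇒≤ p<q))
  ; L-open      = l-open
  ; U-open      = λ {q} (0<q , A<q^k) → let r , 0<r , r<q , A<r^k = ^-down k q A 0<q 0≤A A<q^k in
      r , r<q , 0<r , A<r^k
  ; disjoint    = disj
  ; located     = loc
  }
  where
  A : ℚ
  A = fromℕ a

  0≤A : 0ℚ ≤ A
  0≤A = nonNegative⁻¹ A {{normalize-nonNeg a 1}}

  Lo Up : ℚ → Set
  Lo q = q < 0ℚ ⊎ q ^ k < A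
  Up q = 0ℚ < q × A < q ^ k

  down : ∀ {p q} → p < q → Lo q → Lo p
  down p<q (inj₁ q<0) = inj₁ (<-trans p<q q<0)
  down {p} p<q (inj₂ q^k<A) with p <? 0ℚ
  ... | yes p<0 = inj₁ p<0
  ... | no  p≮0 = inj₂ (≤-<-trans (^-mono-≤ k (≮⇒≥ p≮0) (<⇒≤ p<q)) q^k<A)

  l-open : ∀ {p} → Lo p → ∃ λ q → p < q × Lo q
  l-open (inj₁ p<0) = let q , p<q , q<0 = <-dense p<0 in q , p<q , inj₁ q<0
  l-open {p} (inj₂ p^k<A) with p <? 0ℚ
  ... | yes p<0 = let q , p<q , q<0 = <-dense p<0 in q , p<q , inj₁ q<0
  ... | no  p≮0 = let q , p<q , q^k<A = ^-up k p A (≮⇒≥ p≮0) p^k<A in q , p<q , inj₂ q^k<A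

  disj : ∀ {q} → Lo q → ¬ Up q
  disj (inj₁ q<0)   (0<q , _)     = <-asym q<0 0<q
  disj (inj₂ q^k<A) (_   , A<q^k) = <-asym q^k<A A<q^k

  loc : ∀ {p q} → p < q → Lo p ⊎ Up q
  loc {p} {q} p<q with p <? 0ℚ
  ... | yes p<0 = inj₁ (inj₁ p<0)
  ... | no  p≮0 with p ^ k <? A
  ...   | yes p^k<A = inj₁ (inj₂ p^k<A)
  ...   | no  p^k≮A = inj₂ (≤-<-trans (≮⇒≥ p≮0) p<q ,
                            ≤-<-trans (≮⇒≥ p^k≮A) (^-mono-< k (≮⇒≥ p≮0) p<q))

growth : (m n : ℕ) .{{_ : ℕ.NonZero m}} .{{_ : ℕ.NonZero n}} → ℝ
growth m n = root (order m n) {{order-nonZero m n}} (f m n)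

-- Convergence as both indices, ranging independently over the positive
-- integers, tend to infinity.  Rational tolerances suffice, as every
-- positive real exceeds a positive rational.
DoubleLimit : ((m n : ℕ) .{{_ : ℕ.NonZero m}} .{{_ : ℕ.NonZero n}} → ℝ) → ℝ → Set
DoubleLimit s η =
  ∀ ε → 0ℚ < ε → ∃ λ M →
  ∀ m n .{{_ : ℕ.NonZero m}} .{{_ : ℕ.NonZero n}} →
  M ℕ.≤ m → M ℕ.≤ n → Within ε (s m n) η

-- Let T be the transfer matrix from one odd column to the next.  It is a Gram
-- matrix A Aᵗ, where A is the compatibility of an odd column with an adjacent
-- even one, and f m n = ⟨1, Tᵐ 1⟩.
--
-- Existence of the limit: the entries of T lie between 1 and 2ⁿ⁺¹, so f is
-- multiplicative in each variable (after shifting it by one) up to such factors.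
-- Comparing two rectangles with a common multiple of both gives an explicit
-- Cauchy estimate, and the limit is built from Dedekind cuts.
--
-- Lower bound: by Cauchy–Schwarz f is log-convex in m, whence
-- f (10 + k) n ≥ (f 11 n / f 10 n) ^ k.
--
-- Upper bound: by Cauchy–Schwarz ‖T⁵ u‖² ≤ tr T¹⁰ ‖u‖², whence
-- f (10 j) n ≤ 2ⁿ (tr T¹⁰) ^ j, and tr T¹⁰ counts independent sets on a cylinder
-- of circumference 20 and height n.
--
-- Read row by row, f 10 n, f 11 n and the cylinder count are governed by transfer
-- matrices of fixed size.  Their growth is bounded by log-convexity (from below)
-- and by Collatz–Wielandt (from above), evaluated by computation.

module Submission where

-- Roots and quotients are avoided until the end: a comparison of f^(1/N) with p/q is stated as one
-- of f q^N with p^N in natural numbers, up to a factor C^(m+n). Such a factor is harmless because N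
-- = 2mn + m + n outgrows every multiple of m + n. As existence of the limit is proved separately,
-- each numerical bound is needed only along one unbounded family of rectangles: 10 i by i from
-- above, i + 10 by i + 12 from below. The exponents count vertices. The leading term of N is 2mn,
-- so the ratio of the leading eigenvalues of the strips of widths 11 and 10 bounds η² from below;
-- this takes f 11 n from below and f 10 n from above, hence two kinds of certificate. A cylinder of
-- circumference 20 has 20 vertices per unit of height, so its eigenvalue bounds η²⁰ from above. The
-- shift by one comes from gluing: diamonds of lengths i and j are joined by an extra even column
-- and form one of length i + j + 1.

-- Finite sums and the Cauchy-Schwarz inequality.

module Sums where

  open import Data.Nat
  open import Data.Nat.Properties
  open import Data.Nat.Tactic.RingSolver using (solve-∀)
  open import Data.List.Base using (List; []; _∷_; _++_; map; cartesianProductWith)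
  open import Data.List.Relation.Unary.All using (All; []; _∷_)
  open import Function using (_∘_)
  open import Relation.Binary.PropositionalEquality

  private variable
    A B C : Set

  ∑ : List A → (A → ℕ) → ℕ
  ∑ []       F = 0
  ∑ (x ∷ xs) F = F x + ∑ xs F

  ∑-congᴬ : ∀ {F G : A → ℕ} {xs} → All (λ x → F x ≡ G x) xs → ∑ xs F ≡ ∑ xs G
  ∑-congᴬ []       = refl
  ∑-congᴬ (e ∷ es) = cong₂ _+_ e (∑-congᴬ es)

  ∑-cong : ∀ {F G : A → ℕ} xs → (∀ x → F x ≡ G x) → ∑ xs F ≡ ∑ xs G
  ∑-cong []       e = refl
  ∑-cong (x ∷ xs) e = cong₂ _+_ (e x) (∑-cong xs e)

  ∑-mono : ∀ {F G : A → ℕ} xs → (∀ x → F x ≤ G x) → ∑ xs F ≤ ∑ xs G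
  ∑-mono []       e = z≤n
  ∑-mono (x ∷ xs) e = +-mono-≤ (e x) (∑-mono xs e)

  ∑-++ : ∀ xs ys {F : A → ℕ} → ∑ (xs ++ ys) F ≡ ∑ xs F + ∑ ys F
  ∑-++ []       ys = refl
  ∑-++ (x ∷ xs) ys {F} = trans (cong (F x +_) (∑-++ xs ys)) (sym (+-assoc (F x) _ _))

  ∑-map : ∀ (h : A → B) xs {F} → ∑ (map h xs) F ≡ ∑ xs (F ∘ h)
  ∑-map h []       = refl
  ∑-map h (x ∷ xs) = cong (_ +_) (∑-map h xs)

  ∑-+ : ∀ xs {F G : A → ℕ} → ∑ xs (λ x → F x + G x) ≡ ∑ xs F + ∑ xs G
  ∑-+ []       = refl
  ∑-+ (x ∷ xs) {F} {G} = trans (cong (F x + G x +_) (∑-+ xs)) (lem (F x) (G x) _ _)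
    where
    lem : ∀ a b c d → a + b + (c + d) ≡ a + c + (b + d)
    lem = solve-∀

  ∑-*ˡ : ∀ c xs {F : A → ℕ} → ∑ xs (λ x → c * F x) ≡ c * ∑ xs F
  ∑-*ˡ c []       = sym (*-zeroʳ c)
  ∑-*ˡ c (x ∷ xs) {F} = trans (cong (c * F x +_) (∑-*ˡ c xs)) (sym (*-distribˡ-+ c (F x) _))

  ∑-*ʳ : ∀ c xs {F : A → ℕ} → ∑ xs (λ x → F x * c) ≡ ∑ xs F * c
  ∑-*ʳ c xs = trans (∑-cong xs (λ x → *-comm _ c)) (trans (∑-*ˡ c xs) (*-comm c _))

  ∑-0 : ∀ (xs : List A) → ∑ xs (λ _ → 0) ≡ 0
  ∑-0 []       = refl
  ∑-0 (x ∷ xs) = ∑-0 xs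

  ∑-swap : ∀ xs ys {F : A → B → ℕ} →
           ∑ xs (λ x → ∑ ys (F x)) ≡ ∑ ys (λ y → ∑ xs (λ x → F x y))
  ∑-swap []       ys = sym (∑-0 ys)
  ∑-swap (x ∷ xs) ys = trans (cong (_ +_) (∑-swap xs ys)) (sym (∑-+ ys))

  ∑-× : ∀ (h : A → B → C) xs ys {F} →
        ∑ (cartesianProductWith h xs ys) F ≡ ∑ xs λ x → ∑ ys λ y → F (h x y)
  ∑-× h []       ys = refl
  ∑-× h (x ∷ xs) ys = trans (∑-++ (map (h x) ys) _) (cong₂ _+_ (∑-map (h x) ys) (∑-× h xs ys))

  ∑-*-∑ : ∀ xs ys {F : A → ℕ} {G : B → ℕ} →
          ∑ xs F * ∑ ys G ≡ ∑ xs λ x → ∑ ys λ y → F x * G y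
  ∑-*-∑ xs ys {F} = trans (sym (∑-*ʳ _ xs)) (∑-cong xs (λ x → sym (∑-*ˡ (F x) ys)))

  infix 8 _²
  _² : ℕ → ℕ
  a ² = a * a

  -- Lowering both numbers by one preserves the difference (a - b)² of the two sides, so the
  -- induction runs on both at once.
  2ab≤a²+b² : ∀ a b → 2 * (a * b) ≤ a ² + b ²
  2ab≤a²+b² zero    b       = z≤n
  2ab≤a²+b² (suc a) zero    = subst (_≤ suc a ² + 0) (cong (2 *_) (sym (*-zeroʳ (suc a)))) z≤n
  2ab≤a²+b² (suc a) (suc b) = subst₂ _≤_ (e₁ a b) (e₂ a b) (+-monoˡ-≤ (2 * (a + b) + 2) (2ab≤a²+b² a b))
    where
    e₁ : ∀ a b → 2 * (a * b) + (2 * (a + b) + 2) ≡ 2 * (suc a * suc b)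
    e₁ = solve-∀
    e₂ : ∀ a b → a * a + b * b + (2 * (a + b) + 2) ≡ suc a * suc a + suc b * suc b
    e₂ = solve-∀

  -- Lagrange: sum 2 (aᵢ bⱼ) (aⱼ bᵢ) ≤ (aᵢ bⱼ)² + (aⱼ bᵢ)² over all i and j.
  cauchy-schwarz : ∀ (xs : List A) (F G : A → ℕ) →
                   (∑ xs λ x → F x * G x) ² ≤ ∑ xs (λ x → F x ²) * ∑ xs (λ x → G x ²)
  cauchy-schwarz xs F G = *-cancelˡ-≤ 2 (begin
    2 * (∑ xs λ x → F x * G x) ²
      ≡⟨ cong (2 *_) (∑-*-∑ xs xs) ⟩
    2 * (∑ xs λ x → ∑ xs λ y → F x * G x * (F y * G y))
      ≡⟨ ∑-*ˡ 2 xs ⟨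
    (∑ xs λ x → 2 * ∑ xs λ y → F x * G x * (F y * G y))
      ≡⟨ ∑-cong xs (λ x → sym (∑-*ˡ 2 xs)) ⟩
    (∑ xs λ x → ∑ xs λ y → 2 * (F x * G x * (F y * G y)))
      ≤⟨ ∑-mono xs (λ x → ∑-mono xs (λ y → lem (F x) (G x) (F y) (G y))) ⟩
    (∑ xs λ x → ∑ xs λ y → F x ² * G y ² + F y ² * G x ²)
      ≡⟨ trans (∑-cong xs (λ x → ∑-+ xs)) (∑-+ xs) ⟩
    (∑ xs λ x → ∑ xs λ y → F x ² * G y ²) + (∑ xs λ x → ∑ xs λ y → F y ² * G x ²)
      ≡⟨ cong₂ _+_ (sym (∑-*-∑ xs xs)) (trans (∑-swap xs xs) (sym (∑-*-∑ xs xs))) ⟩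
    P + P
      ≡⟨ cong (P +_) (+-identityʳ P) ⟨
    2 * P ∎)
    where
    open ≤-Reasoning
    P = ∑ xs (λ x → F x ²) * ∑ xs (λ x → G x ²)
    lem : ∀ a b c d → 2 * (a * b * (c * d)) ≤ a ² * d ² + c ² * b ²
    lem a b c d = subst₂ _≤_ (e₁ a b c d) (e₂ a b c d) (2ab≤a²+b² (a * d) (c * b))
      where
      e₁ : ∀ a b c d → 2 * (a * d * (c * b)) ≡ 2 * (a * b * (c * d))
      e₁ = solve-∀
      e₂ : ∀ a b c d → a * d * (a * d) + c * b * (c * b) ≡ a * a * (d * d) + c * c * (b * b)
      e₂ = solve-∀

-- From independent sets to the column transfer matrix.

module Columns where

  open Sums
  open import Defs
  open import Data.Nat.Base hiding (_^_)
  open import Data.Nat.GeneralisedArithmetic using (fold)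
  open import Data.Nat.Properties
  open import Data.Bool.Base using (Bool; false; true; if_then_else_)
  open import Data.List.Base using (List; []; _∷_; _++_; map; cartesianProduct; cartesianProductWith; length; filter; applyUpTo)
  open import Data.List.Properties using (filter-++; filter-accept; filter-reject; map-upTo)
  open import Data.List.Relation.Unary.All as All using (All; []; _∷_; all?)
  open import Data.List.Relation.Unary.All.Properties using (++⁺; ++⁻; ++⁻ˡ; ++⁻ʳ; map⁺)
  open import Data.Product using (_×_; _,_; proj₁; proj₂)
  open import Data.Vec.Base using (Vec; []; _∷_)
  open import Function using (_∘_)
  open import Function.Bundles using (_⇔_; mk⇔; Equivalence)
  open import Relation.Binary.PropositionalEquality
  open import Relation.Nullary using (Dec; yes; no; ¬_; does; contradiction)
  open import Relation.Nullary.Decidable using (¬?)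

  private variable
    A B : Set
    P Q R : Set

  vectors : List A → ∀ k → List (Vec A k)
  vectors xs zero    = [] ∷ []
  vectors xs (suc k) = cartesianProductWith _∷_ xs (vectors xs k)

  states : ∀ n → List (Vec Bool n)
  states = vectors (false ∷ true ∷ [])

  ok : Bool → Bool → ℕ
  ok true  true  = 0
  ok _     _     = 1

  -- The weight of the zigzag b c₁ b₁ c₂ b₂ … when w weighs each consecutive pair.
  path : (A → B → ℕ) → ∀ {k} → B → Vec A k → Vec B k → ℕ
  path w b []       []         = 1
  path w b (c ∷ cs) (b′ ∷ bs) = w c b * w c b′ * path w b′ cs bs

  -- Neighbouring columns of n and n + 1 vertices.
  compat : ∀ {n} → Vec Bool n → Vec Bool (suc n) → ℕ
  compat x (y ∷ ys) = path ok y x ys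

  down : ∀ {n} → (Vec Bool n → ℕ) → Vec Bool (suc n) → ℕ
  down {n} u y = ∑ (states n) λ x → compat x y * u x

  up : ∀ {n} → (Vec Bool (suc n) → ℕ) → Vec Bool n → ℕ
  up {n} u x = ∑ (states (suc n)) λ y → compat x y * u y

  transfer : ∀ {n} → (Vec Bool n → ℕ) → Vec Bool n → ℕ
  transfer u = up (down u)

  -- The vector Tᵐ 1. By `∑-rest` its entry at x counts the ways to continue an odd column in state
  -- x by 2 m further columns.
  extensions : ∀ {n} → ℕ → Vec Bool n → ℕ
  extensions = fold (λ _ → 1) transfer

  ⟦_⟧ : Dec P → ℕ
  ⟦ p ⟧ = if does p then 1 else 0

  length-filter : ∀ {P : A → Set} (P? : ∀ x → Dec (P x)) xs → length (filter P? xs) ≡ ∑ xs (λ x → ⟦ P? x ⟧)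
  length-filter P? []       = refl
  length-filter P? (x ∷ xs) with P? x
  ... | yes _ = cong suc (length-filter P? xs)
  ... | no  _ = length-filter P? xs

  ⟦⟧-≡ : ∀ (p : Dec P) {k} → k ≤ 1 → P ⇔ k ≡ 1 → ⟦ p ⟧ ≡ k
  ⟦⟧-≡ (yes p) k≤1 e = sym (Equivalence.to e p)
  ⟦⟧-≡ (no ¬p) {zero}        k≤1 e = refl
  ⟦⟧-≡ (no ¬p) {suc zero}    k≤1 e = contradiction (Equivalence.from e refl) ¬p
  ⟦⟧-≡ (no ¬p) {suc (suc k)} (s≤s ()) e

  ⟦⟧-× : ∀ (p : Dec P) (q : Dec Q) (r : Dec R) → P ⇔ (Q × R) → ⟦ p ⟧ ≡ ⟦ q ⟧ * ⟦ r ⟧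
  ⟦⟧-× (yes p) (yes q) (yes r) e = refl
  ⟦⟧-× (yes p) (yes q) (no ¬r) e = contradiction (proj₂ (Equivalence.to e p)) ¬r
  ⟦⟧-× (yes p) (no ¬q) r       e = contradiction (proj₁ (Equivalence.to e p)) ¬q
  ⟦⟧-× (no ¬p) (yes q) (yes r) e = contradiction (Equivalence.from e (q , r)) ¬p
  ⟦⟧-× (no ¬p) (yes q) (no ¬r) e = refl
  ⟦⟧-× (no ¬p) (no ¬q) r       e = refl

  ok≤1 : ∀ a b → ok a b ≤ 1
  ok≤1 false b     = ≤-refl
  ok≤1 true  false = ≤-refl
  ok≤1 true  true  = z≤n

  path-ok≤1 : ∀ {k} b (cs bs : Vec Bool k) → path ok b cs bs ≤ 1
  path-ok≤1 b []       []        = ≤-refl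
  path-ok≤1 b (c ∷ cs) (b′ ∷ bs) = *-mono-≤ (*-mono-≤ (ok≤1 c b) (ok≤1 c b′)) (path-ok≤1 b′ cs bs)

  compat≤1 : ∀ {n} (x : Vec Bool n) y → compat x y ≤ 1
  compat≤1 x (y ∷ ys) = path-ok≤1 y x ys

  ∑-subsets-++ : ∀ (xs ys : List A) {F} →
    ∑ (subsets (xs ++ ys)) F ≡ ∑ (subsets xs) λ s → ∑ (subsets ys) λ t → F (s ++ t)
  ∑-subsets-++ []       ys = sym (+-identityʳ _)
  ∑-subsets-++ (x ∷ xs) ys {F} = begin
    ∑ (subsets (xs ++ ys) ++ map (x ∷_) (subsets (xs ++ ys))) F
      ≡⟨ trans (∑-++ (subsets (xs ++ ys)) _) (cong (∑ (subsets (xs ++ ys)) F +_) (∑-map (x ∷_) (subsets (xs ++ ys)))) ⟩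
    ∑ (subsets (xs ++ ys)) F + ∑ (subsets (xs ++ ys)) (F ∘ (x ∷_))
      ≡⟨ cong₂ _+_ (∑-subsets-++ xs ys) (∑-subsets-++ xs ys) ⟩
    ∑ (subsets xs) G + ∑ (subsets xs) (G ∘ (x ∷_))
      ≡⟨ trans (∑-++ (subsets xs) _) (cong (∑ (subsets xs) G +_) (∑-map (x ∷_) (subsets xs))) ⟨
    ∑ (subsets xs ++ map (x ∷_) (subsets xs)) G ∎
    where
    open ≡-Reasoning
    G = λ s → ∑ (subsets ys) λ t → F (s ++ t)

  subsets-All : ∀ {P : A → Set} {xs} → All P xs → All (All P) (subsets xs)
  subsets-All []       = [] ∷ []
  subsets-All (p ∷ ps) = ++⁺ (subsets-All ps) (map⁺ (All.map (p ∷_) (subsets-All ps)))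

  column : ℕ → ℕ → ℕ → List Vertex
  column x y zero    = []
  column x y (suc n) = (x , y) ∷ column x (2 + y) n

  place : ∀ {n} → ℕ → ℕ → Vec Bool n → List Vertex
  place x y []          = []
  place x y (false ∷ b) = place x (2 + y) b
  place x y (true ∷ b)  = (x , y) ∷ place x (2 + y) b

  ∑-column : ∀ x y n {F} → ∑ (subsets (column x y n)) F ≡ ∑ (states n) (F ∘ place x y)
  ∑-column x y zero    = refl
  ∑-column x y (suc n) {F} = begin
    ∑ (subsets V ++ map ((x , y) ∷_) (subsets V)) F
      ≡⟨ trans (∑-++ (subsets V) _) (cong (∑ (subsets V) F +_) (∑-map ((x , y) ∷_) (subsets V))) ⟩
    ∑ (subsets V) F + ∑ (subsets V) (F ∘ ((x , y) ∷_))
      ≡⟨ cong₂ _+_ (∑-column x (2 + y) n) (trans (∑-column x (2 + y) n) (sym (+-identityʳ _))) ⟩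
    (∑ (states n) λ b → F (place x (2 + y) b)) + ((∑ (states n) λ b → F ((x , y) ∷ place x (2 + y) b)) + 0)
      ≡⟨ ∑-× _∷_ (false ∷ true ∷ []) (states n) ⟨
    ∑ (states (suc n)) (F ∘ place x y) ∎
    where
    open ≡-Reasoning
    V = column x (2 + y) n

  rest : ℕ → ℕ → ℕ → List Vertex
  rest n x zero    = []
  rest n x (suc m) = column (suc x) 1 (suc n) ++ column (2 + x) 2 n ++ rest n (2 + x) m

  from : ℕ → ℕ → List ℕ
  from a zero    = []
  from a (suc k) = a ∷ from (suc a) k

  range-from : ∀ k → range k ≡ from 1 k
  range-from k = trans (map-upTo suc k) (go suc k 1 (λ i → +-comm 1 i))
    where
    go : ∀ (g : ℕ → ℕ) k a → (∀ i → g i ≡ i + a) → applyUpTo g k ≡ from a k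
    go g zero    a e = refl
    go g (suc k) a e = cong₂ _∷_ (e 0) (go (g ∘ suc) k (suc a) (λ i → trans (e (suc i)) (sym (+-suc i a))))

  suc-odd : ∀ z → z % 2 ≡ 1 → ¬ suc z % 2 ≡ 1
  suc-odd zero          ()
  suc-odd (suc zero)    _ ()
  suc-odd (suc (suc z)) = suc-odd z

  suc-even : ∀ z → ¬ z % 2 ≡ 1 → suc z % 2 ≡ 1
  suc-even zero          _ = refl
  suc-even (suc zero)    e = contradiction refl e
  suc-even (suc (suc z)) e = suc-even z e

  odd-suc : ∀ x y → Odd (x , y) → ¬ Odd (x , suc y)
  odd-suc x y o = subst (λ z → ¬ z % 2 ≡ 1) (sym (+-suc x y)) (suc-odd (x + y) o)

  even-suc : ∀ x y → ¬ Odd (x , y) → Odd (x , suc y)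
  even-suc x y e = subst (λ z → z % 2 ≡ 1) (sym (+-suc x y)) (suc-even (x + y) e)

  module _ (x : ℕ) where

    vertical : ℕ → ℕ → List Vertex
    vertical y k = map (x ,_) (from y k)

    keep : ∀ y k → Odd (x , y) → filter odd? (vertical y (suc k)) ≡ (x , y) ∷ filter odd? (vertical (suc y) k)
    keep y k = filter-accept odd? {x , y} {vertical (suc y) k}

    skip : ∀ y k → ¬ Odd (x , y) → filter odd? (vertical y (suc k)) ≡ filter odd? (vertical (suc y) k)
    skip y k = filter-reject odd? {x , y} {vertical (suc y) k}

    column-odd : ∀ y k → Odd (x , y) → filter odd? (vertical y (1 + 2 * k)) ≡ column x y (suc k)
    column-odd y zero    o = keep y 0 o
    column-odd y (suc k) o = begin
      filter odd? (vertical y (1 + 2 * suc k))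
        ≡⟨ keep y (2 * suc k) o ⟩
      (x , y) ∷ filter odd? (vertical (suc y) (2 * suc k))
        ≡⟨ cong (λ j → (x , y) ∷ filter odd? (vertical (suc y) j)) (*-suc 2 k) ⟩
      (x , y) ∷ filter odd? (vertical (suc y) (2 + 2 * k))
        ≡⟨ cong ((x , y) ∷_) (skip (suc y) (1 + 2 * k) (odd-suc x y o)) ⟩
      (x , y) ∷ filter odd? (vertical (2 + y) (1 + 2 * k))
        ≡⟨ cong ((x , y) ∷_) (column-odd (2 + y) k (even-suc x (suc y) (odd-suc x y o))) ⟩
      column x y (2 + k) ∎
      where open ≡-Reasoning

    column-even : ∀ y k → ¬ Odd (x , y) → filter odd? (vertical y (1 + 2 * k)) ≡ column x (suc y) k
    column-even y zero    e = skip y 0 e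
    column-even y (suc k) e = begin
      filter odd? (vertical y (1 + 2 * suc k))
        ≡⟨ skip y (2 * suc k) e ⟩
      filter odd? (vertical (suc y) (2 * suc k))
        ≡⟨ cong (λ j → filter odd? (vertical (suc y) j)) (*-suc 2 k) ⟩
      filter odd? (vertical (suc y) (2 + 2 * k))
        ≡⟨ keep (suc y) (1 + 2 * k) (even-suc x y e) ⟩
      (x , suc y) ∷ filter odd? (vertical (2 + y) (1 + 2 * k))
        ≡⟨ cong ((x , suc y) ∷_) (column-even (2 + y) k (odd-suc x (suc y) (even-suc x y e))) ⟩
      column x (suc y) (suc k) ∎
      where open ≡-Reasoning

  -- For odd x the filter keeps the even heights, for even x the odd ones; two columns are taken at
  -- a time so that the parity of x returns.
  columns : ∀ n x m → ¬ Odd (x , 1) →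
    filter odd? (cartesianProduct (from x (1 + 2 * m)) (from 1 (1 + 2 * n))) ≡ column x 2 n ++ rest n x m
  columns n x m e = trans (filter-++ odd? (map (x ,_) (from 1 (1 + 2 * n))) _)
                          (cong₂ _++_ (column-even x 1 n e) (others m))
    where
    o : Odd (suc x , 1)
    o = suc-even (x + 1) e
    others : ∀ m → filter odd? (cartesianProduct (from (suc x) (2 * m)) (from 1 (1 + 2 * n))) ≡ rest n x m
    others zero    = refl
    others (suc m) rewrite +-suc m (m + 0) = trans (filter-++ odd? (map (suc x ,_) (from 1 (1 + 2 * n))) _)
      (cong₂ _++_ (column-odd (suc x) 1 n o) (columns n (2 + x) m (suc-odd (suc x + 1) o)))

  aztec-columns : ∀ m n → aztecVertices m n ≡ column 1 2 n ++ rest n 1 m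
  aztec-columns m n = trans
    (cong₂ (λ xs ys → filter odd? (cartesianProduct xs ys))
      (trans (range-from (2 * m + 1)) (cong (from 1) (+-comm (2 * m) 1)))
      (trans (range-from (2 * n + 1)) (cong (from 1) (+-comm (2 * n) 1))))
    (columns n 1 m λ ())

  -- `Independent s` unfolds to `NoEdges s s`, so independence of a concatenation splits into two
  -- diagonal blocks and a cross block.
  NoEdges : List Vertex → List Vertex → Set
  NoEdges s t = All (λ u → All (λ v → ¬ Adjacent u v) t) s

  noEdges? : ∀ s t → Dec (NoEdges s t)
  noEdges? s t = all? (λ u → all? (λ v → ¬? (adjacent? u v)) t) s

  Adjacent-sym : ∀ u v → Adjacent u v → Adjacent v u
  Adjacent-sym (x , y) (x′ , y′) (p , q) = trans (∣-∣-comm x′ x) p , trans (∣-∣-comm y′ y) q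

  NoEdges-[] : ∀ s → NoEdges s []
  NoEdges-[] s = All.universal (λ _ → []) s

  NoEdges-∷ʳ : ∀ s {v t} → All (λ u → ¬ Adjacent u v) s → NoEdges s t → NoEdges s (v ∷ t)
  NoEdges-∷ʳ []      []       []       = []
  NoEdges-∷ʳ (u ∷ s) (e ∷ es) (n ∷ ns) = (e ∷ n) ∷ NoEdges-∷ʳ s es ns

  NoEdges-sym : ∀ s t → NoEdges s t → NoEdges t s
  NoEdges-sym []      t []       = NoEdges-[] t
  NoEdges-sym (u ∷ s) t (n ∷ ns) = NoEdges-∷ʳ t (All.map (λ {v} e a → e (Adjacent-sym v u a)) n) (NoEdges-sym s t ns)

  NoEdges-++ʳ : ∀ s t t′ → NoEdges s (t ++ t′) ⇔ (NoEdges s t × NoEdges s t′)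
  NoEdges-++ʳ s t t′ = mk⇔
    (λ n → All.map (++⁻ˡ t) n , All.map (++⁻ʳ t) n)
    (λ (n , n′) → All.zipWith (λ (a , b) → ++⁺ a b) (n , n′))

  independent-++ : ∀ s t → Independent (s ++ t) ⇔ (NoEdges s s × NoEdges s t × Independent t)
  independent-++ s t = mk⇔
    (λ n → let n₁ , n₂ = ++⁻ s n
               n₁₁ , n₁₂ = Equivalence.to (NoEdges-++ʳ s s t) n₁
               _   , n₂₂ = Equivalence.to (NoEdges-++ʳ t s t) n₂
           in n₁₁ , n₁₂ , n₂₂)
    (λ (n₁₁ , n₁₂ , n₂₂) → ++⁺ (Equivalence.from (NoEdges-++ʳ s s t) (n₁₁ , n₁₂))
                               (Equivalence.from (NoEdges-++ʳ t s t) (NoEdges-sym s t n₁₂ , n₂₂)))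

  column-x : ∀ x y n → All (λ v → x ≡ proj₁ v) (column x y n)
  column-x x y zero    = []
  column-x x y (suc n) = refl ∷ column-x x (2 + y) n

  rest-x : ∀ n x m → All (λ v → x < proj₁ v) (rest n x m)
  rest-x n x zero    = []
  rest-x n x (suc m) = ++⁺ (All.map (λ {refl → ≤-refl}) (column-x (suc x) 1 (suc n)))
    (++⁺ (All.map (λ {refl → m≤n+m (suc x) 1}) (column-x (2 + x) 2 n))
         (All.map (<-trans (m≤n+m (suc x) 1)) (rest-x n (2 + x) m)))

  place-x : ∀ {n} x y (b : Vec Bool n) → All (λ v → x ≡ proj₁ v) (place x y b)
  place-x x y []          = []
  place-x x y (false ∷ b) = place-x x (2 + y) b
  place-x x y (true ∷ b)  = refl ∷ place-x x (2 + y) b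

  place-y : ∀ {n} x y (b : Vec Bool n) → All (λ v → y ≤ proj₂ v) (place x y b)
  place-y x y []          = []
  place-y x y (false ∷ b) = All.map (≤-trans (m≤n+m y 2)) (place-y x (2 + y) b)
  place-y x y (true ∷ b)  = ≤-refl ∷ All.map (≤-trans (m≤n+m y 2)) (place-y x (2 + y) b)

  ∣x-x∣≢1 : ∀ x → ¬ ∣ x - x ∣ ≡ 1
  ∣x-x∣≢1 x e rewrite ∣n-n∣≡0 x with e
  ... | ()

  far≢1 : ∀ {x x′} → 2 + x ≤ x′ → ¬ ∣ x - x′ ∣ ≡ 1
  far≢1 {zero}  {suc zero} (s≤s ()) e
  far≢1 {zero}  {suc (suc x′)} _ ()
  far≢1 {suc x} {suc x′} (s≤s p) e = far≢1 p e

  module _ {s t : List Vertex} where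
    same-x : ∀ {x} → All (λ v → x ≡ proj₁ v) s → All (λ v → x ≡ proj₁ v) t → NoEdges s t
    same-x {x} ps qs = All.map (λ {refl → All.map (λ {refl (p , _) → ∣x-x∣≢1 x p}) qs}) ps

    far-x : ∀ {x} → All (λ v → x ≡ proj₁ v) s → All (λ v → 2 + x ≤ proj₁ v) t → NoEdges s t
    far-x ps qs = All.map (λ {refl → All.map (λ {q (p , _) → far≢1 q p}) qs}) ps

  far-y : ∀ {x y} {t : List Vertex} → All (λ v → 2 + y ≤ proj₂ v) t → All (λ v → ¬ Adjacent (x , y) v) t
  far-y = All.map (λ q (_ , p) → far≢1 q p)

  ∣1+y-y∣ : ∀ y → ∣ suc y - y ∣ ≡ 1
  ∣1+y-y∣ zero    = refl
  ∣1+y-y∣ (suc y) = ∣1+y-y∣ y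

  ∣y-1+y∣ : ∀ y → ∣ y - suc y ∣ ≡ 1
  ∣y-1+y∣ y = trans (∣-∣-comm y (suc y)) (∣1+y-y∣ y)

  module _ {x x′ : ℕ} (x~x′ : ∣ x - x′ ∣ ≡ 1) where

    -- Each site of b lies halfway in height between two consecutive sites of c and is adjacent to
    -- these alone, which is the zigzag that `path` weighs. Passing to the tails loses `c₀`, which
    -- is at least three below the rest of b.
    compat-NoEdges : ∀ {n} y (b : Vec Bool n) c → NoEdges (place x (suc y) b) (place x′ y c) ⇔ compat b c ≡ 1
    compat-NoEdges y [] (c₀ ∷ []) = mk⇔ (λ _ → refl) (λ _ → [])
    compat-NoEdges y (false ∷ b) (c₀ ∷ c₁ ∷ c) rewrite +-identityʳ (path ok c₁ b c) = mk⇔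
      (λ n → to (drop c₀ n)) (λ e → add c₀ (from′ e))
      where
      open Equivalence (compat-NoEdges (2 + y) b (c₁ ∷ c)) renaming (from to from′)
      drop : ∀ c₀ → NoEdges (place x (3 + y) b) (place x′ y (c₀ ∷ c₁ ∷ c)) → NoEdges (place x (3 + y) b) (place x′ (2 + y) (c₁ ∷ c))
      drop false n = n
      drop true  n = All.map All.tail n
      add : ∀ c₀ → NoEdges (place x (3 + y) b) (place x′ (2 + y) (c₁ ∷ c)) → NoEdges (place x (3 + y) b) (place x′ y (c₀ ∷ c₁ ∷ c))
      add false n = n
      add true  n = NoEdges-∷ʳ (place x (3 + y) b)
        (All.map (λ {u} q a → All.head (far-y {x′} {y} {u ∷ []} (≤-trans (n≤1+n _) q ∷ [])) (Adjacent-sym u (x′ , y) a)) (place-y x (3 + y) b)) n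
    compat-NoEdges y (true ∷ b) (true ∷ c₁ ∷ c) = mk⇔
      (λ n → contradiction (x~x′ , ∣1+y-y∣ y) (All.head (All.head n))) λ ()
    compat-NoEdges y (true ∷ b) (false ∷ true ∷ c) = mk⇔
      (λ n → contradiction (x~x′ , ∣y-1+y∣ y) (All.head (All.head n))) λ ()
    compat-NoEdges y (true ∷ b) (false ∷ false ∷ c) rewrite +-identityʳ (path ok false b c) = mk⇔
      (λ n → to (All.tail n)) (λ e → far-y {x} (All.map (≤-trans (n≤1+n _)) (place-y x′ (4 + y) c)) ∷ from′ e)
      where open Equivalence (compat-NoEdges (2 + y) b (false ∷ c)) renaming (from to from′)

    ⟦NoEdges⟧ : ∀ {n} (b : Vec Bool n) c → ⟦ noEdges? (place x 2 b) (place x′ 1 c) ⟧ ≡ compat b c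
    ⟦NoEdges⟧ b c = ⟦⟧-≡ (noEdges? _ _) (compat≤1 b c) (compat-NoEdges 1 b c)

  -- Adjacent vertices lie in neighbouring columns, so edges have to be excluded only between X and
  -- Y, between Y and Z, and inside Z ++ t. The first two conditions become factors `compat`; what
  -- remains no longer involves b.
  extend : ∀ {n} x (b b′ : Vec Bool n) (c : Vec Bool (suc n)) {t} → All (λ v → 2 + x < proj₁ v) t →
    ⟦ independent? (place x 2 b ++ place (suc x) 1 c ++ place (2 + x) 2 b′ ++ t) ⟧ ≡
    compat b c * (compat b′ c * ⟦ independent? (place (2 + x) 2 b′ ++ t) ⟧)
  extend x b b′ c {t} far = begin
    ⟦ independent? (X ++ Y ++ Z ++ t) ⟧
      ≡⟨ ⟦⟧-× (independent? _) (noEdges? X Y) (independent? (Y ++ Z ++ t)) (mk⇔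
           (λ i → let _ , n , i′ = to (independent-++ X _) i in proj₁ (to (NoEdges-++ʳ X Y _) n) , i′)
           (λ (n , i) → from′ (independent-++ X _) (same-x x∈X x∈X ,
             from′ (NoEdges-++ʳ X Y _) (n , far-x x∈X (++⁺ (All.map (λ {refl → ≤-refl}) x∈Z) (All.map <⇒≤ far))) , i))) ⟩
    ⟦ noEdges? X Y ⟧ * ⟦ independent? (Y ++ Z ++ t) ⟧
      ≡⟨ cong₂ _*_ (⟦NoEdges⟧ (∣y-1+y∣ x) b c)
          (⟦⟧-× (independent? _) (noEdges? Z Y) (independent? (Z ++ t)) (mk⇔
           (λ i → let _ , n , i′ = to (independent-++ Y _) i in
             NoEdges-sym Y Z (proj₁ (to (NoEdges-++ʳ Y Z t) n)) , i′)
           (λ (n , i) → from′ (independent-++ Y _) (same-x x∈Y x∈Y ,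
             from′ (NoEdges-++ʳ Y Z t) (NoEdges-sym Z Y n , far-x x∈Y far) , i)))) ⟩
    compat b c * (⟦ noEdges? Z Y ⟧ * ⟦ independent? (Z ++ t) ⟧)
      ≡⟨ cong (λ k → compat b c * (k * _)) (⟦NoEdges⟧ (∣1+y-y∣ (suc x)) b′ c) ⟩
    compat b c * (compat b′ c * ⟦ independent? (Z ++ t) ⟧) ∎
    where
    open ≡-Reasoning
    open Equivalence using (to) renaming (from to from′)
    X = place x 2 b
    Y = place (suc x) 1 c
    Z = place (2 + x) 2 b′
    x∈X = place-x x 2 b
    x∈Y = place-x (suc x) 1 c
    x∈Z = place-x (2 + x) 2 b′

  -- Summing `extend` over the states c and b′ of the next two columns applies `transfer` once,
  -- since the part beyond them sees b′ alone.
  ∑-rest : ∀ n m x (b : Vec Bool n) →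
    ∑ (subsets (rest n x m)) (λ t → ⟦ independent? (place x 2 b ++ t) ⟧) ≡ extensions m b
  ∑-rest n zero x b = cong (_+ 0) (⟦⟧-≡ (independent? _) ≤-refl (mk⇔ (λ _ → refl)
    (λ _ → Equivalence.from (independent-++ _ []) (same-x (place-x x 2 b) (place-x x 2 b) , NoEdges-[] _ , []))))
  ∑-rest n (suc m) x b = begin
    ∑ (subsets (column (suc x) 1 (suc n) ++ column (2 + x) 2 n ++ rest n (2 + x) m)) (λ t → ⟦ independent? (place x 2 b ++ t) ⟧)
      ≡⟨ trans (∑-subsets-++ (column (suc x) 1 (suc n)) _) (∑-column (suc x) 1 (suc n)) ⟩
    (∑ (states (suc n)) λ c → ∑ (subsets (column (2 + x) 2 n ++ rest n (2 + x) m)) λ t →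
      ⟦ independent? (place x 2 b ++ place (suc x) 1 c ++ t) ⟧)
      ≡⟨ ∑-cong (states (suc n)) (λ c → trans (∑-subsets-++ (column (2 + x) 2 n) _) (∑-column (2 + x) 2 n)) ⟩
    (∑ (states (suc n)) λ c → ∑ (states n) λ b′ → ∑ (subsets (rest n (2 + x) m)) λ t →
      ⟦ independent? (place x 2 b ++ place (suc x) 1 c ++ place (2 + x) 2 b′ ++ t) ⟧)
      ≡⟨ ∑-cong (states (suc n)) (λ c → ∑-cong (states n) (λ b′ →
           trans (∑-congᴬ (All.map (extend x b b′ c) (subsets-All (rest-x n (2 + x) m))))
             (trans (∑-*ˡ (compat b c) (subsets (rest n (2 + x) m)))
               (cong (compat b c *_) (trans (∑-*ˡ (compat b′ c) (subsets (rest n (2 + x) m)))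
                 (cong (compat b′ c *_) (∑-rest n m (2 + x) b′))))))) ⟩
    (∑ (states (suc n)) λ c → ∑ (states n) λ b′ → compat b c * (compat b′ c * extensions m b′))
      ≡⟨ ∑-cong (states (suc n)) (λ c → ∑-*ˡ (compat b c) (states n)) ⟩
    extensions (suc m) b ∎
    where open ≡-Reasoning

  f-extensions : ∀ m n → f m n ≡ ∑ (states n) (extensions m)
  f-extensions m n = begin
    f m n
      ≡⟨ length-filter independent? (subsets (aztecVertices m n)) ⟩
    ∑ (subsets (aztecVertices m n)) (λ t → ⟦ independent? t ⟧)
      ≡⟨ cong (λ V → ∑ (subsets V) (λ t → ⟦ independent? t ⟧)) (aztec-columns m n) ⟩
    ∑ (subsets (column 1 2 n ++ rest n 1 m)) (λ t → ⟦ independent? t ⟧)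
      ≡⟨ trans (∑-subsets-++ (column 1 2 n) (rest n 1 m)) (∑-column 1 2 n) ⟩
    (∑ (states n) λ b → ∑ (subsets (rest n 1 m)) λ t → ⟦ independent? (place 1 2 b ++ t) ⟧)
      ≡⟨ ∑-cong (states n) (∑-rest n m 1) ⟩
    ∑ (states n) (extensions m) ∎
    where open ≡-Reasoning

-- Reading configurations by rows: transposition and cylinders.

module Rows where

  open Sums
  open Columns
  open import Defs using (f)
  open import Data.Nat.Base
  open import Data.Nat.GeneralisedArithmetic using (fold)
  open import Data.Nat.Properties
  open import Data.Nat.Tactic.RingSolver using (solve-∀)
  open import Data.Bool.Base using (Bool; false; true)
  open import Data.List.Base using (List; []; _∷_)
  open import Data.Vec.Base using (Vec; []; _∷_; _∷ʳ_; zipWith; head; tail)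
  open import Function using (flip)
  open import Relation.Binary.PropositionalEquality

  private variable
    A B : Set

  ok-comm : ∀ a b → ok a b ≡ ok b a
  ok-comm false false = refl
  ok-comm false true  = refl
  ok-comm true  false = refl
  ok-comm true  true  = refl

  down-cong : ∀ {n} {u v : Vec Bool n → ℕ} → (∀ x → u x ≡ v x) → ∀ y → down u y ≡ down v y
  down-cong {n} e y = ∑-cong (states n) (λ x → cong (compat x y *_) (e x))

  up-cong : ∀ {n} {u v : Vec Bool (suc n) → ℕ} → (∀ y → u y ≡ v y) → ∀ x → up u x ≡ up v x
  up-cong {n} e x = ∑-cong (states (suc n)) (λ y → cong (compat x y *_) (e y))

  transfer-cong : ∀ {n} {u v : Vec Bool n → ℕ} → (∀ x → u x ≡ v x) → ∀ x → transfer u x ≡ transfer v x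
  transfer-cong e = up-cong (down-cong e)

  ∑-∷ : ∀ (xs : List A) k {F : Vec A (suc k) → ℕ} →
    ∑ (vectors xs (suc k)) F ≡ ∑ xs λ x → ∑ (vectors xs k) λ v → F (x ∷ v)
  ∑-∷ xs k = ∑-× _∷_ xs (vectors xs k)

  prepend : ∀ {n k} → Vec Bool k → Vec (Vec Bool n) k → Vec (Vec Bool (suc n)) k
  prepend = zipWith _∷_

  ∑-prepend : ∀ n k {F : Vec (Vec Bool (suc n)) k → ℕ} →
    ∑ (vectors (states (suc n)) k) F ≡
    ∑ (states k) λ r → ∑ (vectors (states n) k) λ v → F (prepend r v)
  ∑-prepend n zero        = sym (+-identityʳ _)
  ∑-prepend n (suc k) {F} = begin
    ∑ (vectors (states (suc n)) (suc k)) F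
      ≡⟨ trans (∑-∷ (states (suc n)) k) (∑-∷ bits n) ⟩
    (∑ bits λ b → ∑ (states n) λ x → ∑ (vectors (states (suc n)) k) λ xs → F ((b ∷ x) ∷ xs))
      ≡⟨ ∑-cong bits (λ b → ∑-cong (states n) (λ x → ∑-prepend n k {λ xs → F ((b ∷ x) ∷ xs)})) ⟩
    (∑ bits λ b → ∑ (states n) λ x → ∑ (states k) λ r → ∑ (vectors (states n) k) λ v → G b r (x ∷ v))
      ≡⟨ ∑-cong bits (λ b → ∑-swap (states n) (states k) {λ x r → ∑ (vectors (states n) k) λ v → G b r (x ∷ v)}) ⟩
    (∑ bits λ b → ∑ (states k) λ r → ∑ (states n) λ x → ∑ (vectors (states n) k) λ v → G b r (x ∷ v))
      ≡⟨ ∑-cong bits (λ b → ∑-cong (states k) (λ r → sym (∑-∷ (states n) k {G b r}))) ⟩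
    (∑ bits λ b → ∑ (states k) λ r → ∑ (vectors (states n) (suc k)) (G b r))
      ≡⟨ ∑-∷ bits k {λ r → ∑ (vectors (states n) (suc k)) λ v → F (prepend r v)} ⟨
    (∑ (states (suc k)) λ r → ∑ (vectors (states n) (suc k)) λ v → F (prepend r v)) ∎
    where
    open ≡-Reasoning
    bits : List Bool
    bits = false ∷ true ∷ []
    G : Bool → Vec Bool k → Vec (Vec Bool n) (suc k) → ℕ
    G b r v = F (prepend (b ∷ r) v)

  -- The bottom row β of the short columns has edges only to the row γ below it and to the row γ′
  -- above it. Splitting these off leaves a configuration of the same kind with bottom row γ′.
  path-prepend : ∀ {n k} β₀ b₀ (γ γ′ : Vec Bool k) cs β (bs : Vec (Vec Bool n) k) →
    path (flip compat) (β₀ ∷ b₀) (prepend γ (prepend γ′ cs)) (prepend β bs) ≡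
    path ok β₀ γ β * (path ok β₀ γ′ β * path (flip compat) b₀ (prepend γ′ cs) bs)
  path-prepend β₀ b₀ []      []        []       []      []       = refl
  path-prepend β₀ b₀ (g ∷ γ) (g′ ∷ γ′) (c ∷ cs) (β₁ ∷ β) (b₁ ∷ bs)
    rewrite path-prepend β₁ b₁ γ γ′ cs β bs
          | ok-comm g β₀ | ok-comm g β₁ | ok-comm g′ β₀ | ok-comm g′ β₁
    = lem (ok β₀ g) (ok β₀ g′) (path ok g′ b₀ c) (ok β₁ g) (ok β₁ g′) (path ok g′ b₁ c) _ _ _
    where
    lem : ∀ a a′ p b b′ q x y z → a * a′ * p * (b * b′ * q) * (x * (y * z)) ≡ a * b * x * (a′ * b′ * y * (p * q * z))
    lem = solve-∀

  -- Sites b, c₁, b₁, …, cⱼ, bⱼ of a row or column, where b ∷ … are the sites of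
  -- the first kind and close selects b₁, …, bⱼ among them: open strips drop b,
  -- cylinders return to it.
  module Exchange {j k} (close : ∀ {B : Set} → Vec B (suc k) → Vec B j)
    (close-prepend : ∀ {n} β (b : Vec (Vec Bool n) (suc k)) → close (prepend β b) ≡ prepend (close β) (close b))
    where

    weight : (A → B → ℕ) → Vec B (suc k) → Vec A j → ℕ
    weight w bs cs = path w (head bs) cs (close bs)

    rowDown : (Vec Bool j → ℕ) → Vec Bool (suc k) → ℕ
    rowDown u β = ∑ (states j) λ γ → weight ok β γ * u γ

    rowUp : (Vec Bool (suc k) → ℕ) → Vec Bool j → ℕ
    rowUp u γ = ∑ (states (suc k)) λ β → weight ok β γ * u β

    rowTransfer : (Vec Bool j → ℕ) → Vec Bool j → ℕ
    rowTransfer u = rowUp (rowDown u)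

    weight-prepend : ∀ {n} β (b : Vec (Vec Bool n) (suc k)) γ γ′ cs →
      weight (flip compat) (prepend β b) (prepend γ (prepend γ′ cs)) ≡
      weight ok β γ * (weight ok β γ′ * weight (flip compat) b (prepend γ′ cs))
    weight-prepend β@(β₀ ∷ _) b@(b₀ ∷ _) γ γ′ cs =
      trans (cong (path (flip compat) (β₀ ∷ b₀) (prepend γ (prepend γ′ cs))) (close-prepend β b))
            (path-prepend β₀ b₀ γ γ′ cs (close β) (close b))

    path-empty : ∀ {i} (b : Vec Bool 0) (γ : Vec Bool i) cs bs → path (flip compat) b (prepend γ cs) bs ≡ 1
    path-empty []  []      []        []        = refl
    path-empty []  (g ∷ γ) ([] ∷ cs) ([] ∷ bs) = trans (+-identityʳ _) (path-empty [] γ cs bs)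

    ∑-empty : ∀ i {F : Vec (Vec Bool 0) i → ℕ} → (∀ v → F v ≡ 1) → ∑ (vectors (states 0) i) F ≡ 1
    ∑-empty zero    e = trans (+-identityʳ _) (e [])
    ∑-empty (suc i) e = trans (∑-× _∷_ (states 0) (vectors (states 0) i)) (trans (+-identityʳ _) (∑-empty i (λ v → e ([] ∷ v))))

    -- The bottom row γ of the long columns is held fixed while the rows above are summed out; each
    -- pair of rows β, γ′ contributes one application of `rowTransfer`.
    strips : ∀ n γ →
      (∑ (vectors (states n) (suc k)) λ b → ∑ (vectors (states n) j) λ cs → weight (flip compat) b (prepend γ cs))
      ≡ fold (λ _ → 1) rowTransfer n γ
    strips zero γ = ∑-empty (suc k) λ b → ∑-empty j λ cs → path-empty (head b) γ cs (close b)
    strips (suc n) γ = begin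
      (∑ (vectors (states (suc n)) (suc k)) λ b → ∑ (vectors (states (suc n)) j) λ cs → W b (prepend γ cs))
        ≡⟨ ∑-prepend n (suc k) ⟩
      (∑ (states (suc k)) λ β → ∑ (vectors (states n) (suc k)) λ b → ∑ (vectors (states (suc n)) j) λ cs →
        W (prepend β b) (prepend γ cs))
        ≡⟨ ∑-cong (states (suc k)) (λ β → ∑-cong Bs (λ b → trans (∑-prepend n j)
            (∑-cong (states j) (λ γ′ → trans (∑-cong Cs (λ cs → weight-prepend β b γ γ′ cs))
              (trans (∑-*ˡ (weight ok β γ) Cs) (cong (weight ok β γ *_) (∑-*ˡ (weight ok β γ′) Cs))))))) ⟩
      (∑ (states (suc k)) λ β → ∑ Bs λ b → ∑ (states j) λ γ′ →
        weight ok β γ * (weight ok β γ′ * ∑ Cs λ cs → W b (prepend γ′ cs)))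
        ≡⟨ ∑-cong (states (suc k)) (λ β → trans (∑-swap Bs (states j))
            (trans (∑-cong (states j) (λ γ′ → trans (∑-*ˡ (weight ok β γ) Bs)
              (cong (weight ok β γ *_) (trans (∑-*ˡ (weight ok β γ′) Bs) (cong (weight ok β γ′ *_) (strips n γ′))))))
              (∑-*ˡ (weight ok β γ) (states j)))) ⟩
      fold (λ _ → 1) rowTransfer (suc n) γ ∎
      where
      open ≡-Reasoning
      W : ∀ {n} → Vec (Vec Bool n) (suc k) → Vec (Vec Bool (suc n)) j → ℕ
      W = weight (flip compat)
      Bs = vectors (states n) (suc k)
      Cs = vectors (states n) j

    exchange : ∀ n →
      (∑ (vectors (states n) (suc k)) λ b → ∑ (vectors (states (suc n)) j) λ cs → weight (flip compat) b cs)
      ≡ ∑ (states j) (fold (λ _ → 1) rowTransfer n)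
    exchange n = trans (∑-cong (vectors (states n) (suc k)) (λ b → ∑-prepend n j))
      (trans (∑-swap (vectors (states n) (suc k)) (states j)) (∑-cong (states j) (strips n)))

  transfer-∑ : ∀ {n i j} {u : Vec Bool n → ℕ} {P : Vec Bool n → Vec A i → Vec B j → ℕ} as bs →
    (∀ x → u x ≡ ∑ as λ a → ∑ bs (P x a)) → ∀ x →
    transfer u x ≡ ∑ (states (suc n)) λ c → ∑ as λ a → ∑ (states n) λ x′ → ∑ bs λ b →
      compat x c * compat x′ c * P x′ a b
  transfer-∑ {n = n} {u = u} {P} as bs e x = ∑-cong (states (suc n)) λ c → begin
    compat x c * (∑ (states n) λ x′ → compat x′ c * u x′)
      ≡⟨ ∑-*ˡ (compat x c) (states n) ⟨
    (∑ (states n) λ x′ → compat x c * (compat x′ c * u x′))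
      ≡⟨ ∑-cong (states n) (λ x′ → trans (sym (*-assoc (compat x c) (compat x′ c) (u x′)))
           (trans (cong (compat x c * compat x′ c *_) (e x′))
             (trans (sym (∑-*ˡ (compat x c * compat x′ c) as)) (∑-cong as λ a → sym (∑-*ˡ (compat x c * compat x′ c) bs {P x′ a}))))) ⟩
    (∑ (states n) λ x′ → ∑ as λ a → ∑ bs λ b → compat x c * compat x′ c * P x′ a b)
      ≡⟨ ∑-swap (states n) as ⟩
    (∑ as λ a → ∑ (states n) λ x′ → ∑ bs λ b → compat x c * compat x′ c * P x′ a b) ∎
    where open ≡-Reasoning

  extensions-path : ∀ {n} m x → extensions m x ≡
    ∑ (vectors (states (suc n)) m) λ cs → ∑ (vectors (states n) m) λ bs → path (flip compat) x cs bs
  extensions-path         zero    x = refl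
  extensions-path {n = n} (suc m) x = trans (transfer-∑ {P = path (flip compat)} (vectors (states (suc n)) m) (vectors (states n) m) (extensions-path m) x)
    (sym (trans (∑-∷ (states (suc n)) m) (∑-cong (states (suc n)) λ c → ∑-cong (vectors (states (suc n)) m) λ cs →
      ∑-∷ (states n) m)))

  -- The matrix of the (k+1)-st power of transfer.
  kernel : ∀ {n} → ℕ → Vec Bool n → Vec Bool n → ℕ
  kernel k z = fold (λ x → up (compat z) x) transfer k

  kernel-path : ∀ {n} k (z x : Vec Bool n) → kernel k z x ≡
    ∑ (vectors (states (suc n)) (suc k)) λ cs → ∑ (vectors (states n) k) λ bs → path (flip compat) x cs (bs ∷ʳ z)
  kernel-path {n} zero    z x = sym (trans (∑-∷ (states (suc n)) 0) (∑-cong (states (suc n)) λ c →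
    trans (+-identityʳ _) (trans (+-identityʳ _) (*-identityʳ _))))
  kernel-path {n} (suc k) z x = trans (transfer-∑ {P = λ x cs bs → path (flip compat) x cs (bs ∷ʳ z)}
      (vectors (states (suc n)) (suc k)) (vectors (states n) k) (kernel-path k z) x)
    (sym (trans (∑-∷ (states (suc n)) (suc k)) (∑-cong (states (suc n)) λ c → ∑-cong (vectors (states (suc n)) (suc k)) λ cs →
      ∑-∷ (states n) k)))

  tail-prepend : ∀ {n k} β (b : Vec (Vec Bool n) (suc k)) → tail (prepend β b) ≡ prepend (tail β) (tail b)
  tail-prepend (_ ∷ _) (_ ∷ _) = refl

  module _ (m n : ℕ) where
    open Exchange {m} {m} tail tail-prepend

    private
      rowTransfer-transfer : ∀ u γ → rowTransfer u γ ≡ transfer u γ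
      rowTransfer-transfer u γ = ∑-cong (states (suc m)) λ β → cong₂ _*_ (lem γ β)
        (∑-cong (states m) λ γ′ → cong (_* u γ′) (lem γ′ β))
        where
        lem : ∀ γ β → weight ok β γ ≡ compat γ β
        lem γ (_ ∷ _) = refl

      rowTransfer-extensions : ∀ i γ → fold (λ _ → 1) rowTransfer i γ ≡ extensions i γ
      rowTransfer-extensions zero    γ = refl
      rowTransfer-extensions (suc i) γ =
        trans (rowTransfer-transfer _ γ) (transfer-cong (rowTransfer-extensions i) γ)

    -- With `tail` as `close`, the rows form a strip of the same kind and `rowTransfer` is
    -- `transfer`. This is reflection in the diagonal, carried out on states.
    f-sym : f m n ≡ f n m
    f-sym = begin
      f m n
        ≡⟨ f-extensions m n ⟩
      ∑ (states n) (extensions m)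
        ≡⟨ ∑-cong (states n) (λ x → trans (extensions-path m x) (∑-swap (vectors (states (suc n)) m) (vectors (states n) m))) ⟩
      (∑ (states n) λ b → ∑ (vectors (states n) m) λ bs → ∑ (vectors (states (suc n)) m) λ cs → path (flip compat) b cs bs)
        ≡⟨ ∑-∷ (states n) m ⟨
      (∑ (vectors (states n) (suc m)) λ b → ∑ (vectors (states (suc n)) m) λ cs → weight (flip compat) b cs)
        ≡⟨ exchange n ⟩
      ∑ (states m) (fold (λ _ → 1) rowTransfer n)
        ≡⟨ ∑-cong (states m) (rowTransfer-extensions n) ⟩
      ∑ (states m) (extensions n)
        ≡⟨ f-extensions n m ⟨
      f n m ∎
      where open ≡-Reasoning

  trace : ℕ → ℕ → ℕ
  trace k n = ∑ (states n) λ x → kernel k x x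

  -- The zigzag that starts at b runs through bs and returns to b, which closes a strip to a
  -- cylinder.
  rotate : ∀ {k} → Vec A (suc k) → Vec A (suc k)
  rotate (b ∷ bs) = bs ∷ʳ b

  prepend-∷ʳ : ∀ {n k} (β : Vec Bool k) (bs : Vec (Vec Bool n) k) β₀ b₀ →
    prepend β bs ∷ʳ (β₀ ∷ b₀) ≡ prepend (β ∷ʳ β₀) (bs ∷ʳ b₀)
  prepend-∷ʳ []      []       β₀ b₀ = refl
  prepend-∷ʳ (_ ∷ β) (_ ∷ bs) β₀ b₀ = cong (_ ∷_) (prepend-∷ʳ β bs β₀ b₀)

  rotate-prepend : ∀ {n k} β (b : Vec (Vec Bool n) (suc k)) → rotate (prepend β b) ≡ prepend (rotate β) (rotate b)
  rotate-prepend (β₀ ∷ β) (b₀ ∷ bs) = prepend-∷ʳ β bs β₀ b₀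

  module Cylinder (k : ℕ) where
    open Exchange {suc k} {k} rotate rotate-prepend public

    -- The trace of Tᵏ⁺¹ sums over closed paths, that is, over configurations on a cylinder with k +
    -- 1 columns of each kind. Read by rows, the matrix has a size independent of the height n.
    trace-rows : ∀ n → trace k n ≡ ∑ (states (suc k)) (fold (λ _ → 1) rowTransfer n)
    trace-rows n = begin
      trace k n
        ≡⟨ ∑-cong (states n) (λ x → trans (kernel-path k x x) (∑-swap (vectors (states (suc n)) (suc k)) (vectors (states n) k))) ⟩
      (∑ (states n) λ b → ∑ (vectors (states n) k) λ bs → ∑ (vectors (states (suc n)) (suc k)) λ cs →
        path (flip compat) b cs (bs ∷ʳ b))
        ≡⟨ ∑-∷ (states n) k ⟨
      (∑ (vectors (states n) (suc k)) λ b → ∑ (vectors (states (suc n)) (suc k)) λ cs → weight (flip compat) b cs)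
        ≡⟨ exchange n ⟩
      ∑ (states (suc k)) (fold (λ _ → 1) rowTransfer n) ∎
      where open ≡-Reasoning

-- Inequalities for f: log-convexity, gluing, the Cauchy estimate and the trace bound.

module Growth where

  open Sums
  open Columns
  open Rows
  open import Defs using (f; order)
  open import Data.Nat.Base
  open import Data.Nat.GeneralisedArithmetic using (fold; fold-+)
  open import Data.Nat.Properties
  open import Data.Nat.Tactic.RingSolver using (solve-∀)
  open import Data.Bool.Base using (Bool; false; true)
  open import Data.List.Base using ([]; _∷_)
  open import Data.Product using (∃; _,_)
  open import Data.Sum.Base using (_⊎_; inj₁; inj₂)
  open import Data.Vec.Base using (Vec; []; _∷_; replicate)
  open import Relation.Binary.PropositionalEquality

  infix 8 _∙_
  _∙_ : ∀ {n} → (Vec Bool n → ℕ) → (Vec Bool n → ℕ) → ℕ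
  _∙_ {n} u v = ∑ (states n) λ x → u x * v x

  ∙-comm : ∀ {n} (u v : Vec Bool n → ℕ) → u ∙ v ≡ v ∙ u
  ∙-comm {n} u v = ∑-cong (states n) (λ x → *-comm (u x) (v x))

  up-∙ : ∀ {n} w (v : Vec Bool n → ℕ) → up w ∙ v ≡ w ∙ down v
  up-∙ {n} w v = begin
    (∑ (states n) λ x → (∑ (states (suc n)) λ y → compat x y * w y) * v x)
      ≡⟨ ∑-cong (states n) (λ x → sym (∑-*ʳ (v x) (states (suc n)))) ⟩
    (∑ (states n) λ x → ∑ (states (suc n)) λ y → compat x y * w y * v x)
      ≡⟨ ∑-swap (states n) (states (suc n)) ⟩
    (∑ (states (suc n)) λ y → ∑ (states n) λ x → compat x y * w y * v x)
      ≡⟨ ∑-cong (states (suc n)) (λ y → trans (∑-cong (states n) (λ x → lem (compat x y) (w y) (v x))) (∑-*ˡ (w y) (states n))) ⟩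
    w ∙ down v ∎
    where
    open ≡-Reasoning
    lem : ∀ a b c → a * b * c ≡ b * (a * c)
    lem = solve-∀

  transfer-∙ : ∀ {n} (u v : Vec Bool n → ℕ) → transfer u ∙ v ≡ u ∙ transfer v
  transfer-∙ u v = begin
    transfer u ∙ v    ≡⟨ up-∙ (down u) v ⟩
    down u ∙ down v   ≡⟨ ∙-comm (down u) (down v) ⟩
    down v ∙ down u   ≡⟨ up-∙ (down v) u ⟨
    transfer v ∙ u    ≡⟨ ∙-comm (transfer v) u ⟩
    u ∙ transfer v    ∎
    where open ≡-Reasoning

  f-∙ : ∀ i j n → f (i + j) n ≡ extensions {n} i ∙ extensions j
  f-∙ zero    j n = trans (f-extensions j n) (∑-cong (states n) (λ x → sym (*-identityˡ _)))
  f-∙ (suc i) j n = begin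
    f (suc i + j) n                   ≡⟨ cong (λ k → f k n) (+-suc i j) ⟨
    f (i + suc j) n                   ≡⟨ f-∙ i (suc j) n ⟩
    extensions {n} i ∙ extensions {n} (suc j) ≡⟨ transfer-∙ (extensions {n} i) (extensions j) ⟨
    extensions {n} (suc i) ∙ extensions j ∎
    where open ≡-Reasoning

  f-∙-odd : ∀ i j n → f (suc (i + j)) n ≡ down (extensions {n} i) ∙ down (extensions j)
  f-∙-odd i j n = trans (f-∙ (suc i) j n) (up-∙ (down (extensions i)) (extensions {n} j))

  halve : ∀ j → ∃ λ i → j ≡ i + i ⊎ j ≡ suc (i + i)
  halve zero = 0 , inj₁ refl
  halve (suc j) with halve j
  ... | i , inj₁ refl = i , inj₂ refl
  ... | i , inj₂ refl = suc i , inj₁ (cong suc (sym (+-suc i i)))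

  -- For j = 2 i the three values are inner products of Tⁱ 1 and Tⁱ⁺¹ 1; for j = 2 i + 1 they are
  -- inner products of Aᵗ Tⁱ 1 and Aᵗ Tⁱ⁺¹ 1. Cauchy-Schwarz applies to either pair.
  f-logConvex : ∀ j n → f (1 + j) n ² ≤ f j n * f (2 + j) n
  f-logConvex j n with halve j
  ... | i , inj₁ refl = subst₂ _≤_
    (cong _² (sym (trans (cong (λ k → f k n) (sym (+-suc i i))) (f-∙ i (suc i) n))))
    (cong₂ _*_ (sym (f-∙ i i n)) (sym (trans (cong (λ k → f (suc k) n) (sym (+-suc i i))) (f-∙ (suc i) (suc i) n))))
    (cauchy-schwarz (states n) (extensions i) (extensions (suc i)))
  ... | i , inj₂ refl = subst₂ _≤_
    (cong _² (sym (trans (cong (λ k → f (suc k) n) (sym (+-suc i i))) (f-∙-odd i (suc i) n))))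
    (cong₂ _*_ (sym (f-∙-odd i i n)) (sym (trans (cong (λ k → f (2 + k) n) (sym (+-suc i i))) (f-∙-odd (suc i) (suc i) n))))
    (cauchy-schwarz (states (suc n)) (down (extensions i)) (down (extensions (suc i))))

  ∑-states≥ : ∀ n {F : Vec Bool n → ℕ} → F (replicate n false) ≤ ∑ (states n) F
  ∑-states≥ zero        = m≤m+n _ 0
  ∑-states≥ (suc n) {F} = ≤-trans (∑-states≥ n {λ x → F (false ∷ x)})
    (≤-trans (m≤m+n _ _) (≤-reflexive (sym (∑-∷ (false ∷ true ∷ []) n {F}))))

  ∑-const : ∀ n c → ∑ (states n) (λ _ → c) ≡ 2 ^ n * c
  ∑-const zero    c = refl
  ∑-const (suc n) c = trans (∑-∷ (false ∷ true ∷ []) n) (trans (cong (λ s → s + (s + 0)) (∑-const n c))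
    (sym (*-assoc 2 (2 ^ n) c)))

  compat-false : ∀ {n} (x : Vec Bool n) → compat x (replicate (suc n) false) ≡ 1
  compat-false []      = refl
  compat-false (b ∷ x) rewrite ok-comm b false | compat-false x = refl

  down≤∑ : ∀ {n} (u : Vec Bool n → ℕ) y → down u y ≤ ∑ (states n) u
  down≤∑ {n} u y = ∑-mono (states n) (λ x → subst (compat x y * u x ≤_) (*-identityˡ (u x)) (*-monoˡ-≤ (u x) (compat≤1 x y)))

  down-false : ∀ {n} (u : Vec Bool n → ℕ) → ∑ (states n) u ≤ down u (replicate (suc n) false)
  down-false {n} u = ∑-mono (states n) (λ x → ≤-reflexive (sym (trans (cong (_* u x) (compat-false x)) (*-identityˡ (u x)))))

  -- If the even column that joins two diamonds is kept empty, the two sides do not constrain each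
  -- other.
  f-suc≥ : ∀ i j n → f i n * f j n ≤ f (suc (i + j)) n
  f-suc≥ i j n = begin
    f i n * f j n
      ≡⟨ cong₂ _*_ (f-extensions i n) (f-extensions j n) ⟩
    ∑ (states n) e * ∑ (states n) e′
      ≤⟨ *-mono-≤ (down-false e) (down-false e′) ⟩
    down e (replicate (suc n) false) * down e′ (replicate (suc n) false)
      ≤⟨ ∑-states≥ (suc n) {λ y → down e y * down e′ y} ⟩
    down e ∙ down e′
      ≡⟨ f-∙-odd i j n ⟨
    f (suc (i + j)) n ∎
    where
    open ≤-Reasoning
    e e′ : Vec Bool n → ℕ
    e = extensions i
    e′ = extensions j

  -- Dropping the edges at the joining column frees its n + 1 vertices.
  f-suc≤ : ∀ i j n → f (suc (i + j)) n ≤ 2 ^ suc n * (f i n * f j n)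
  f-suc≤ i j n = begin
    f (suc (i + j)) n
      ≡⟨ f-∙-odd i j n ⟩
    down e ∙ down e′
      ≤⟨ ∑-mono (states (suc n)) (λ y → *-mono-≤ (down≤∑ e y) (down≤∑ e′ y)) ⟩
    (∑ (states (suc n)) λ _ → ∑ (states n) e * ∑ (states n) e′)
      ≡⟨ ∑-const (suc n) _ ⟩
    2 ^ suc n * (∑ (states n) e * ∑ (states n) e′)
      ≡⟨ cong (2 ^ suc n *_) (cong₂ _*_ (f-extensions i n) (f-extensions j n)) ⟨
    2 ^ suc n * (f i n * f j n) ∎
    where
    open ≤-Reasoning
    e e′ : Vec Bool n → ℕ
    e = extensions i
    e′ = extensions j

  f-zero : ∀ n → f 0 n ≡ 2 ^ n
  f-zero n = trans (f-extensions 0 n) (trans (∑-const n 1) (*-identityʳ _))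

  f-pos : ∀ m n → 0 < f m n
  f-pos zero    n = subst (0 <_) (sym (f-zero n)) (m^n>0 2 n)
  f-pos (suc m) n = ≤-trans (*-mono-≤ (f-pos 0 n) (f-pos m n)) (f-suc≥ 0 m n)

  f≤2^order : ∀ m n → f m n ≤ 2 ^ order m n
  f≤2^order zero    n = ≤-reflexive (f-zero n)
  f≤2^order (suc m) n = begin
    f (suc m) n                                ≤⟨ f-suc≤ 0 m n ⟩
    2 ^ suc n * (f 0 n * f m n)                ≤⟨ *-monoʳ-≤ (2 ^ suc n) (*-mono-≤ (≤-reflexive (f-zero n)) (f≤2^order m n)) ⟩
    2 ^ suc n * (2 ^ n * 2 ^ order m n)        ≡⟨ cong (2 ^ suc n *_) (^-distribˡ-+-* 2 n (order m n)) ⟨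
    2 ^ suc n * 2 ^ (n + order m n)            ≡⟨ ^-distribˡ-+-* 2 (suc n) (n + order m n) ⟨
    2 ^ (suc n + (n + order m n))              ≡⟨ cong (2 ^_) (lem m n) ⟩
    2 ^ order (suc m) n ∎
    where
    open ≤-Reasoning
    lem : ∀ m n → suc n + (n + (2 * m * n + m + n)) ≡ 2 * suc m * n + suc m + n
    lem = solve-∀

  -- The order m + j (m + 1) is the one with m + j (m + 1) + 1 = (j + 1) (m + 1).
  f-power≤ : ∀ j m n → f m n ^ suc j ≤ f (m + j * suc m) n
  f-power≤ zero    m n = ≤-reflexive (trans (*-identityʳ _) (cong (λ k → f k n) (sym (+-identityʳ m))))
  f-power≤ (suc j) m n = begin
    f m n * f m n ^ suc j           ≤⟨ *-monoʳ-≤ (f m n) (f-power≤ j m n) ⟩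
    f m n * f (m + j * suc m) n     ≤⟨ f-suc≥ m (m + j * suc m) n ⟩
    f (suc (m + (m + j * suc m))) n ≡⟨ cong (λ k → f k n) (+-suc m (m + j * suc m)) ⟨
    f (m + suc j * suc m) n         ∎
    where open ≤-Reasoning

  f-power≥ : ∀ j m n → f (m + j * suc m) n ≤ 2 ^ (suc n * suc j) * f m n ^ suc j
  f-power≥ zero m n = begin
    f (m + 0) n                      ≡⟨ cong (λ k → f k n) (+-identityʳ m) ⟩
    f m n                            ≡⟨ *-identityʳ (f m n) ⟨
    f m n ^ 1                        ≤⟨ m≤n*m (f m n ^ 1) (2 ^ (suc n * 1)) {{>-nonZero (m^n>0 2 (suc n * 1))}} ⟩
    2 ^ (suc n * 1) * f m n ^ 1      ∎
    where open ≤-Reasoning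
  f-power≥ (suc j) m n = begin
    f (m + suc j * suc m) n
      ≡⟨ cong (λ k → f k n) (+-suc m (m + j * suc m)) ⟩
    f (suc (m + (m + j * suc m))) n
      ≤⟨ f-suc≤ m (m + j * suc m) n ⟩
    2 ^ suc n * (f m n * f (m + j * suc m) n)
      ≤⟨ *-monoʳ-≤ (2 ^ suc n) (*-monoʳ-≤ (f m n) (f-power≥ j m n)) ⟩
    2 ^ suc n * (f m n * (2 ^ (suc n * suc j) * f m n ^ suc j))
      ≡⟨ lem (2 ^ suc n) (f m n) (2 ^ (suc n * suc j)) (f m n ^ suc j) ⟩
    2 ^ suc n * 2 ^ (suc n * suc j) * f m n ^ suc (suc j)
      ≡⟨ cong (_* f m n ^ suc (suc j)) (trans (sym (^-distribˡ-+-* 2 (suc n) (suc n * suc j)))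
           (cong (2 ^_) (sym (*-suc (suc n) (suc j))))) ⟩
    2 ^ (suc n * suc (suc j)) * f m n ^ suc (suc j) ∎
    where
    open ≤-Reasoning
    lem : ∀ a b c d → a * (b * (c * d)) ≡ a * c * (b * d)
    lem = solve-∀

  ^-distribʳ-* : ∀ a b k → (a * b) ^ k ≡ a ^ k * b ^ k
  ^-distribʳ-* a b zero    = refl
  ^-distribʳ-* a b (suc k) = trans (cong (a * b *_) (^-distribʳ-* a b k)) (lem a b (a ^ k) (b ^ k))
    where
    lem : ∀ a b c d → a * b * (c * d) ≡ a * c * (b * d)
    lem = solve-∀

  -- Both sides are compared through the rectangle whose side lengths, plus one, are multiples of both.
  f-compare : ∀ m n m′ n′ →
    f m n ^ (suc m′ * suc n′) ≤ 2 ^ ((suc m′ + suc n′) * (suc m * suc n)) * f m′ n′ ^ (suc m * suc n)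
  f-compare m n m′ n′ = begin
    f m n ^ (suc m′ * suc n′)
      ≡⟨ ^-*-assoc (f m n) (suc m′) (suc n′) ⟨
    (f m n ^ suc m′) ^ suc n′
      ≤⟨ ^-monoˡ-≤ (suc n′) (f-power≤ m′ m n) ⟩
    f M n ^ suc n′
      ≡⟨ cong (_^ suc n′) (f-sym M n) ⟩
    f n M ^ suc n′
      ≤⟨ f-power≤ n′ n M ⟩
    f (n + n′ * suc n) M
      ≡⟨ f-sym (n + n′ * suc n) M ⟩
    f M (n + n′ * suc n)
      ≡⟨ cong₂ f (common m m′) (common n n′) ⟩
    f (m′ + m * suc m′) N
      ≤⟨ f-power≥ m m′ N ⟩
    2 ^ (suc N * suc m) * f m′ N ^ suc m
      ≡⟨ cong (λ k → 2 ^ (suc N * suc m) * k ^ suc m) (f-sym m′ N) ⟩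
    2 ^ (suc N * suc m) * f N m′ ^ suc m
      ≤⟨ *-monoʳ-≤ (2 ^ (suc N * suc m)) (^-monoˡ-≤ (suc m) (f-power≥ n n′ m′)) ⟩
    2 ^ (suc N * suc m) * (2 ^ (suc m′ * suc n) * f n′ m′ ^ suc n) ^ suc m
      ≡⟨ cong (2 ^ (suc N * suc m) *_) (^-distribʳ-* (2 ^ (suc m′ * suc n)) (f n′ m′ ^ suc n) (suc m)) ⟩
    2 ^ (suc N * suc m) * ((2 ^ (suc m′ * suc n)) ^ suc m * (f n′ m′ ^ suc n) ^ suc m)
      ≡⟨ *-assoc (2 ^ (suc N * suc m)) _ _ ⟨
    2 ^ (suc N * suc m) * (2 ^ (suc m′ * suc n)) ^ suc m * (f n′ m′ ^ suc n) ^ suc m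
      ≡⟨ cong₂ _*_
           (trans (cong (2 ^ (suc N * suc m) *_) (^-*-assoc 2 (suc m′ * suc n) (suc m)))
             (trans (sym (^-distribˡ-+-* 2 (suc N * suc m) _)) (cong (2 ^_) (exponent m n m′ n′))))
           (trans (^-*-assoc (f n′ m′) (suc n) (suc m)) (cong₂ _^_ (f-sym n′ m′) (*-comm (suc n) (suc m)))) ⟩
    2 ^ ((suc m′ + suc n′) * (suc m * suc n)) * f m′ n′ ^ (suc m * suc n) ∎
    where
    open ≤-Reasoning
    M = m + m′ * suc m
    N = n′ + n * suc n′
    common : ∀ m m′ → m + m′ * suc m ≡ m′ + m * suc m′
    common = solve-∀
    exponent : ∀ m n m′ n′ → suc (n′ + n * suc n′) * suc m + suc m′ * suc n * suc m ≡ (suc m′ + suc n′) * (suc m * suc n)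
    exponent = solve-∀

  -- After roots of order N N′ k this is the Cauchy estimate: f m n ^ (1/N) exceeds f m′ n′ ^ (1/N′)
  -- at most by the factor 2 ^ (1/k).
  f-cauchy : ∀ k m n m′ n′ → 1 ≤ k → 8 * k ≤ m → 8 * k ≤ n → 8 * k ≤ m′ → 8 * k ≤ n′ →
    f m n ^ (order m′ n′ * k) ≤ f m′ n′ ^ (order m n * k) * 2 ^ (order m n * order m′ n′)
  f-cauchy k m n m′ n′ 1≤k km kn km′ kn′ = begin
    F ^ (N′ * k)
      ≡⟨ ^-*-assoc F N′ k ⟨
    (F ^ N′) ^ k
      ≤⟨ ^-monoˡ-≤ k bound ⟩
    (F′ ^ N * 2 ^ E) ^ k
      ≡⟨ ^-distribʳ-* (F′ ^ N) (2 ^ E) k ⟩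
    (F′ ^ N) ^ k * (2 ^ E) ^ k
      ≡⟨ cong₂ _*_ (^-*-assoc F′ N k) (^-*-assoc 2 E k) ⟩
    F′ ^ (N * k) * 2 ^ (E * k)
      ≤⟨ *-monoʳ-≤ (F′ ^ (N * k)) (^-monoʳ-≤ 2 small) ⟩
    F′ ^ (N * k) * 2 ^ (N * N′) ∎
    where
    open ≤-Reasoning
    F = f m n
    F′ = f m′ n′
    N = order m n
    N′ = order m′ n′
    a = suc m
    b = suc n
    a′ = suc m′
    b′ = suc n′
    -- The first summand is the error exponent of `f-compare`, doubled by squaring. The second
    -- bounds F′ ^ (a + b), the surplus from replacing N = 2ab - (a + b) by 2ab, through F′ ≤ 2 ^
    -- (2a′b′).
    E = 2 * ((a′ + b′) * (a * b)) + 2 * (a′ * b′) * (a + b)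
    instance
      F≢0 : NonZero F
      F≢0 = >-nonZero (f-pos m n)

    order-suc : ∀ m n → 2 * m * n + m + n + (suc m + suc n) ≡ 2 * (suc m * suc n)
    order-suc = solve-∀

    order≤ : ∀ m n → order m n ≤ 2 * (suc m * suc n)
    order≤ m n = subst (order m n ≤_) (order-suc m n) (m≤m+n _ _)

    order≥ : ∀ m n → 8 * k ≤ m → 8 * k ≤ n → suc m * suc n ≤ order m n
    order≥ m n p q = subst₂ _≤_ (e₁ m n) (e₂ m n) (+-monoʳ-≤ (m * n + m + n) (*-mono-≤ (1≤ p) (1≤ q)))
      where
      1≤ : ∀ {m} → 8 * k ≤ m → 1 ≤ m
      1≤ = ≤-trans (*-mono-≤ {1} {8} (s≤s z≤n) 1≤k)
      e₁ : ∀ m n → m * n + m + n + 1 ≡ suc m * suc n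
      e₁ = solve-∀
      e₂ : ∀ m n → m * n + m + n + m * n ≡ 2 * m * n + m + n
      e₂ = solve-∀

    bound : F ^ N′ ≤ F′ ^ N * 2 ^ E
    bound = begin
      F ^ N′
        ≤⟨ ^-monoʳ-≤ F (order≤ m′ n′) ⟩
      F ^ (2 * (a′ * b′))
        ≡⟨ trans (cong (F ^_) (*-comm 2 (a′ * b′))) (sym (^-*-assoc F (a′ * b′) 2)) ⟩
      (F ^ (a′ * b′)) ^ 2
        ≤⟨ ^-monoˡ-≤ 2 (f-compare m n m′ n′) ⟩
      (2 ^ ((a′ + b′) * (a * b)) * F′ ^ (a * b)) ^ 2
        ≡⟨ ^-distribʳ-* (2 ^ ((a′ + b′) * (a * b))) (F′ ^ (a * b)) 2 ⟩
      (2 ^ ((a′ + b′) * (a * b))) ^ 2 * (F′ ^ (a * b)) ^ 2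
        ≡⟨ cong₂ _*_ (trans (^-*-assoc 2 ((a′ + b′) * (a * b)) 2) (cong (2 ^_) (*-comm ((a′ + b′) * (a * b)) 2)))
                     (trans (^-*-assoc F′ (a * b) 2) (cong (F′ ^_) (trans (*-comm (a * b) 2) (sym (order-suc m n))))) ⟩
      2 ^ (2 * ((a′ + b′) * (a * b))) * F′ ^ (N + (a + b))
        ≡⟨ cong (2 ^ (2 * ((a′ + b′) * (a * b))) *_) (^-distribˡ-+-* F′ N (a + b)) ⟩
      2 ^ (2 * ((a′ + b′) * (a * b))) * (F′ ^ N * F′ ^ (a + b))
        ≤⟨ *-monoʳ-≤ (2 ^ (2 * ((a′ + b′) * (a * b)))) (*-monoʳ-≤ (F′ ^ N)
            (^-monoˡ-≤ (a + b) (≤-trans (f≤2^order m′ n′) (^-monoʳ-≤ 2 (order≤ m′ n′))))) ⟩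
      2 ^ (2 * ((a′ + b′) * (a * b))) * (F′ ^ N * (2 ^ (2 * (a′ * b′))) ^ (a + b))
        ≡⟨ cong (λ z → 2 ^ (2 * ((a′ + b′) * (a * b))) * (F′ ^ N * z)) (^-*-assoc 2 (2 * (a′ * b′)) (a + b)) ⟩
      2 ^ (2 * ((a′ + b′) * (a * b))) * (F′ ^ N * 2 ^ (2 * (a′ * b′) * (a + b)))
        ≡⟨ lem (2 ^ (2 * ((a′ + b′) * (a * b)))) (F′ ^ N) (2 ^ (2 * (a′ * b′) * (a + b))) ⟩
      F′ ^ N * (2 ^ (2 * ((a′ + b′) * (a * b))) * 2 ^ (2 * (a′ * b′) * (a + b)))
        ≡⟨ cong (F′ ^ N *_) (^-distribˡ-+-* 2 (2 * ((a′ + b′) * (a * b))) (2 * (a′ * b′) * (a + b))) ⟨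
      F′ ^ N * 2 ^ E ∎
      where
      lem : ∀ x y z → x * (y * z) ≡ y * (x * z)
      lem = solve-∀

    side : ∀ {m n} → 8 * k ≤ m → 8 * k ≤ n → 8 * k * (suc m + suc n) ≤ 2 * (suc m * suc n)
    side {m} {n} p q = subst₂ _≤_ (sym (*-distribˡ-+ (8 * k) (suc m) (suc n))) (e (suc m) (suc n))
      (+-mono-≤ (*-monoˡ-≤ (suc m) (m≤n⇒m≤1+n q)) (*-monoˡ-≤ (suc n) (m≤n⇒m≤1+n p)))
      where
      e : ∀ a b → b * a + a * b ≡ 2 * (a * b)
      e = solve-∀

    -- By `side`, each of the two summands of 4 E k is at most 2 (a b) (a′ b′); this fixes the
    -- constant 8 in the hypotheses.
    small : E * k ≤ N * N′
    small = ≤-trans (*-cancelˡ-≤ 4 (subst₂ _≤_ (e₁ a b a′ b′ k) (e₂ (a * b) (a′ * b′))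
      (+-mono-≤ (*-monoˡ-≤ (a * b) (side km′ kn′)) (*-monoˡ-≤ (a′ * b′) (side km kn)))))
      (*-mono-≤ (order≥ m n km kn) (order≥ m′ n′ km′ kn′))
      where
      e₁ : ∀ a b a′ b′ k → 8 * k * (a′ + b′) * (a * b) + 8 * k * (a + b) * (a′ * b′) ≡
           4 * ((2 * ((a′ + b′) * (a * b)) + 2 * (a′ * b′) * (a + b)) * k)
      e₁ = solve-∀
      e₂ : ∀ x y → 2 * y * x + 2 * x * y ≡ 4 * (x * y)
      e₂ = solve-∀

  kernel-∙ : ∀ {n} i z (u : Vec Bool n → ℕ) → kernel i z ∙ u ≡ fold u transfer (suc i) z
  kernel-∙ zero    z u = up-∙ (compat z) u
  kernel-∙ (suc i) z u = begin
    transfer (kernel i z) ∙ u            ≡⟨ transfer-∙ (kernel i z) u ⟩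
    kernel i z ∙ transfer u              ≡⟨ kernel-∙ i z (transfer u) ⟩
    fold (transfer u) transfer (suc i) z ≡⟨ cong (λ v → v z) (fold-+ u transfer (suc i) {1}) ⟨
    fold u transfer (suc i + 1) z        ≡⟨ cong (λ k → fold u transfer k z) (+-comm (suc i) 1) ⟩
    fold u transfer (suc (suc i)) z      ∎
    where open ≡-Reasoning

  -- trace (2 i + 1) n is the squared Frobenius norm of the (i+1)-st power.
  norm-bound : ∀ {n} i (u : Vec Bool n → ℕ) →
    fold u transfer (suc i) ∙ fold u transfer (suc i) ≤ trace (suc i + i) n * (u ∙ u)
  norm-bound {n} i u = begin
    (∑ (states n) λ z → fold u transfer (suc i) z ²)
      ≡⟨ ∑-cong (states n) (λ z → cong _² (sym (kernel-∙ i z u))) ⟩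
    (∑ (states n) λ z → (kernel i z ∙ u) ²)
      ≤⟨ ∑-mono (states n) (λ z → cauchy-schwarz (states n) (kernel i z) u) ⟩
    (∑ (states n) λ z → kernel i z ∙ kernel i z * (u ∙ u))
      ≡⟨ ∑-*ʳ (u ∙ u) (states n) ⟩
    (∑ (states n) λ z → kernel i z ∙ kernel i z) * (u ∙ u)
      ≡⟨ cong (_* (u ∙ u)) (∑-cong (states n) (λ z → trans (kernel-∙ i z (kernel i z))
           (sym (cong (λ v → v z) (fold-+ (λ x → up (compat z) x) transfer (suc i) {i}))))) ⟩
    trace (suc i + i) n * (u ∙ u) ∎
    where open ≤-Reasoning

  -- The left side is the squared norm of T^(j (i + 1)) 1. Each block T^(i + 1) costs a factor tr
  -- T^(2 i + 2), and the vector 1 has squared norm 2ⁿ.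
  f-trace : ∀ i j n → f (j * suc i + j * suc i) n ≤ trace (suc i + i) n ^ j * 2 ^ n
  f-trace i zero    n = ≤-reflexive (trans (f-zero n) (sym (*-identityˡ _)))
  f-trace i (suc j) n = begin
    f (suc j * suc i + suc j * suc i) n
      ≡⟨ f-∙ (suc j * suc i) (suc j * suc i) n ⟩
    extensions {n} (suc i + j * suc i) ∙ extensions (suc i + j * suc i)
      ≡⟨ cong (λ (v : Vec Bool n → ℕ) → v ∙ v) (fold-+ (λ _ → 1) transfer (suc i) {j * suc i}) ⟩
    fold u transfer (suc i) ∙ fold u transfer (suc i)
      ≤⟨ norm-bound i u ⟩
    trace (suc i + i) n * (u ∙ u)
      ≡⟨ cong (trace (suc i + i) n *_) (f-∙ (j * suc i) (j * suc i) n) ⟨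
    trace (suc i + i) n * f (j * suc i + j * suc i) n
      ≤⟨ *-monoʳ-≤ (trace (suc i + i) n) (f-trace i j n) ⟩
    trace (suc i + i) n * (trace (suc i + i) n ^ j * 2 ^ n)
      ≡⟨ *-assoc (trace (suc i + i) n) _ _ ⟨
    trace (suc i + i) n ^ suc j * 2 ^ n ∎
    where
    open ≤-Reasoning
    u : Vec Bool n → ℕ
    u = extensions (j * suc i)

-- Eigenvalue bounds by evaluation on tabulated vectors.

module Tables where

  open Sums
  open Columns
  open Rows
  open Growth
  open import Defs using (f)
  open import Data.Nat.Base
  open import Data.Nat.GeneralisedArithmetic using (fold)
  open import Data.Nat.Properties
  open import Data.Nat.Tactic.RingSolver using (solve-∀)
  open import Data.Bool.Base using (Bool; false; true; _∧_; T)
  open import Data.Bool.Properties using (T-∧)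
  open import Data.List.Base using (List; []; _∷_)
  open import Data.Product using (∃; _×_; _,_; proj₁; proj₂)
  open import Data.Unit.Base using (tt)
  open import Data.Vec.Base using (Vec; []; _∷_; _∷ʳ_)
  open import Function.Bundles using (Equivalence)
  open import Relation.Binary.PropositionalEquality

  private variable
    A B : Set
    n : ℕ

  module _ (xs : List A) (ys : List B) (w : A → B → ℕ) where

    -- Common form of `transfer` and `rowTransfer`, so that strips and cylinders share one
    -- eigenvalue bound.
    gram : (A → ℕ) → A → ℕ
    gram u x = ∑ ys λ y → w x y * ∑ xs λ x′ → w x′ y * u x′

    gram-mono : ∀ {u v} → (∀ x → u x ≤ v x) → ∀ x → gram u x ≤ gram v x
    gram-mono le x = ∑-mono ys λ y → *-monoʳ-≤ (w x y) (∑-mono xs λ x′ → *-monoʳ-≤ (w x′ y) (le x′))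

    gram-* : ∀ c u x → gram (λ x′ → c * u x′) x ≡ c * gram u x
    gram-* c u x = trans (∑-cong ys λ y → trans
        (cong (w x y *_) (trans (∑-cong xs λ x′ → lem (w x′ y) c (u x′)) (∑-*ˡ c xs)))
        (lem (w x y) c (∑ xs λ x′ → w x′ y * u x′)))
      (∑-*ˡ c ys)
      where
      lem : ∀ a b c → a * (b * c) ≡ b * (a * c)
      lem = solve-∀

    -- A matrix M with nonnegative entries preserves the order of vectors, so 1 ≤ v and M v ≤ (N /
    -- D) v propagate to Mⁿ 1 ≤ (N / D)ⁿ v.
    collatz-wielandt : ∀ D N v → (∀ x → 1 ≤ v x) → (∀ x → D * gram v x ≤ N * v x) →
      ∀ n x → D ^ n * fold (λ _ → 1) gram n x ≤ N ^ n * v x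
    collatz-wielandt D N v pos le zero    x = +-monoˡ-≤ 0 (pos x)
    collatz-wielandt D N v pos le (suc n) x = begin
      D * D ^ n * gram u x              ≡⟨ *-assoc D (D ^ n) _ ⟩
      D * (D ^ n * gram u x)            ≡⟨ cong (D *_) (gram-* (D ^ n) u x) ⟨
      D * gram (λ x → D ^ n * u x) x    ≤⟨ *-monoʳ-≤ D (gram-mono (collatz-wielandt D N v pos le n) x) ⟩
      D * gram (λ x → N ^ n * v x) x    ≡⟨ cong (D *_) (gram-* (N ^ n) v x) ⟩
      D * (N ^ n * gram v x)            ≡⟨ lem D (N ^ n) (gram v x) ⟩
      N ^ n * (D * gram v x)            ≤⟨ *-monoʳ-≤ (N ^ n) (le x) ⟩
      N ^ n * (N * v x)                 ≡⟨ lem′ (N ^ n) N (v x) ⟩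
      N ^ suc n * v x                   ∎
      where
      open ≤-Reasoning
      u : A → ℕ
      u = fold (λ _ → 1) gram n
      lem : ∀ a b c → a * (b * c) ≡ b * (a * c)
      lem = solve-∀
      lem′ : ∀ a b c → a * (b * c) ≡ b * a * c
      lem′ = solve-∀

    total-bound : ∀ D N v → (∀ x → 1 ≤ v x) → (∀ x → D * gram v x ≤ N * v x) →
      ∀ n → ∑ xs (fold (λ _ → 1) gram n) * D ^ n ≤ ∑ xs v * N ^ n
    total-bound D N v pos le n = subst₂ _≤_
      (trans (∑-*ˡ (D ^ n) xs) (*-comm (D ^ n) _)) (trans (∑-*ˡ (N ^ n) xs) (*-comm (N ^ n) _))
      (∑-mono xs (collatz-wielandt D N v pos le n))

  -- Functions on Vec Bool n, tabulated so that products with transfer matrices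
  -- cost n 2ⁿ additions.
  data Tree : ℕ → Set where
    leaf : ℕ → Tree 0
    node : Tree n → Tree n → Tree (suc n)

  infixl 9 _!_
  _!_ : Tree n → Vec Bool n → ℕ
  leaf a   ! []          = a
  node s t ! (false ∷ x) = s ! x
  node s t ! (true ∷ x)  = t ! x

  constant : ℕ → ∀ n → Tree n
  constant c zero    = leaf c
  constant c (suc n) = node (constant c n) (constant c n)

  infixl 6 _⊕_
  _⊕_ : Tree n → Tree n → Tree n
  leaf a   ⊕ leaf b     = leaf (a + b)
  node s t ⊕ node s′ t′ = node (s ⊕ s′) (t ⊕ t′)

  total : Tree n → ℕ
  total (leaf a)   = a
  total (node s t) = total s + total t

  -- Sums out γ site by site, b being the site of β just passed. The next site of γ is free exactly
  -- when both its neighbours in β are empty; its two subtrees are then merged before the recursion.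
  descend : Bool → Tree n → Tree n
  descend b     (leaf a)   = leaf a
  descend false (node s t) = node (descend false (s ⊕ t)) (descend true s)
  descend true  (node s t) = node (descend false s) (descend true s)

  -- Here s and t are the sums with the next site of β empty or occupied. An occupied site of γ
  -- admits only the former, and only if b is empty.
  combine : Bool → Tree n → Tree n → Tree (suc n)
  combine false s t = node (s ⊕ t) s
  combine true  s t = node (s ⊕ t) (constant 0 _)

  ascend : Bool → Tree n → Tree n
  ascend b (leaf a)   = leaf a
  ascend b (node s t) = combine b (ascend false s) (ascend true t)

  -- Closes the cylinder: the last site of β has to be the one at which the zigzag started, and
  -- `cylinderStep` sums over the state of that site.
  endingIn : Bool → Tree (suc n) → Tree (suc n)
  endingIn false (node (leaf a) (leaf b))              = node (leaf a) (leaf 0)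
  endingIn true  (node (leaf a) (leaf b))              = node (leaf 0) (leaf b)
  endingIn c     (node s@(node _ _) t@(node _ _)) = node (endingIn c s) (endingIn c t)

  stripStep : Tree n → Tree n
  stripStep t = ascend false (descend false t) ⊕ ascend true (descend true t)

  cylinderStep : Tree (suc n) → Tree (suc n)
  cylinderStep t = ascend false (endingIn false (descend false t)) ⊕ ascend true (endingIn true (descend true t))

  !-constant : ∀ c (x : Vec Bool n) → constant c n ! x ≡ c
  !-constant c []          = refl
  !-constant c (false ∷ x) = !-constant c x
  !-constant c (true ∷ x)  = !-constant c x

  !-⊕ : ∀ (s t : Tree n) x → (s ⊕ t) ! x ≡ s ! x + t ! x
  !-⊕ (leaf a)   (leaf b)     []          = refl
  !-⊕ (node s t) (node s′ t′) (false ∷ x) = !-⊕ s s′ x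
  !-⊕ (node s t) (node s′ t′) (true ∷ x)  = !-⊕ t t′ x

  bits : List Bool
  bits = false ∷ true ∷ []

  ∑-bits : ∀ n {F : Vec Bool (suc n) → ℕ} →
    ∑ (states (suc n)) F ≡ (∑ (states n) λ x → F (false ∷ x)) + (∑ (states n) λ x → F (true ∷ x))
  ∑-bits n {F} = trans (∑-∷ bits n) (cong ((∑ (states n) λ x → F (false ∷ x)) +_) (+-identityʳ (∑ (states n) λ x → F (true ∷ x))))

  total-∑ : ∀ (t : Tree n) → total t ≡ ∑ (states n) (t !_)
  total-∑ (leaf a)           = sym (+-identityʳ a)
  total-∑ (node {n = n} s t) = trans (cong₂ _+_ (total-∑ s) (total-∑ t)) (sym (∑-bits n))

  ∑-1* : ∀ n (F G : Vec Bool n → ℕ) → (∑ (states n) λ x → (F x + 0) * G x) ≡ ∑ (states n) λ x → F x * G x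
  ∑-1* n F G = ∑-cong (states n) λ x → cong (_* G x) (+-identityʳ (F x))

  !-descend : ∀ b (t : Tree n) β → descend b t ! β ≡ ∑ (states n) λ γ → path ok b γ β * t ! γ
  !-descend b (leaf a) [] = sym (trans (+-identityʳ _) (*-identityˡ a))
  !-descend false (node {n = n} s t) (false ∷ β) = begin
    descend false (s ⊕ t) ! β
      ≡⟨ !-descend false (s ⊕ t) β ⟩
    (∑ (states n) λ γ → path ok false γ β * (s ⊕ t) ! γ)
      ≡⟨ trans (∑-cong (states n) λ γ → trans (cong (path ok false γ β *_) (!-⊕ s t γ)) (*-distribˡ-+ (path ok false γ β) _ _)) (∑-+ (states n)) ⟩
    (∑ (states n) λ γ → path ok false γ β * s ! γ) + (∑ (states n) λ γ → path ok false γ β * t ! γ)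
      ≡⟨ cong₂ _+_ (∑-1* n (λ γ → path ok false γ β) (s !_)) (∑-1* n (λ γ → path ok false γ β) (t !_)) ⟨
    (∑ (states n) λ γ → (path ok false γ β + 0) * s ! γ) + (∑ (states n) λ γ → (path ok false γ β + 0) * t ! γ)
      ≡⟨ ∑-bits n ⟨
    (∑ (states (suc n)) λ γ → path ok false γ (false ∷ β) * node s t ! γ) ∎
    where open ≡-Reasoning
  !-descend false (node {n = n} s t) (true ∷ β) = sym (trans (∑-bits n) (trans
    (cong₂ _+_ (∑-1* n (λ γ → path ok true γ β) (s !_)) (∑-0 (states n))) (trans (+-identityʳ _) (sym (!-descend true s β)))))
  !-descend true (node {n = n} s t) (false ∷ β) = sym (trans (∑-bits n) (trans
    (cong₂ _+_ (∑-1* n (λ γ → path ok false γ β) (s !_)) (∑-0 (states n))) (trans (+-identityʳ _) (sym (!-descend false s β)))))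
  !-descend true (node {n = n} s t) (true ∷ β) = sym (trans (∑-bits n) (trans
    (cong₂ _+_ (∑-1* n (λ γ → path ok true γ β) (s !_)) (∑-0 (states n))) (trans (+-identityʳ _) (sym (!-descend true s β)))))

  !-ascend : ∀ b (t : Tree n) γ → ascend b t ! γ ≡ ∑ (states n) λ β → path ok b γ β * t ! β
  !-ascend b (leaf a) [] = sym (trans (+-identityʳ _) (*-identityˡ a))
  !-ascend b (node {n = n} s t) (false ∷ γ) = trans (lem b) (trans
    (trans (!-⊕ (ascend false s) (ascend true t) γ) (cong₂ _+_ (!-ascend false s γ) (!-ascend true t γ)))
    (sym (trans (∑-bits n) (cong₂ _+_ (∑-1* n (path ok false γ) (s !_)) (∑-1* n (path ok true γ) (t !_))))))
    where
    lem : ∀ b → combine b (ascend false s) (ascend true t) ! (false ∷ γ) ≡ (ascend false s ⊕ ascend true t) ! γ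
    lem false = refl
    lem true  = refl
  !-ascend false (node {n = n} s t) (true ∷ γ) = sym (trans (∑-bits n) (trans
    (cong₂ _+_ (∑-1* n (path ok false γ) (s !_)) (∑-0 (states n))) (trans (+-identityʳ _) (sym (!-ascend false s γ)))))
  !-ascend true (node {n = n} s t) (true ∷ γ) = trans (!-constant 0 γ) (sym (trans (∑-bits n)
    (cong₂ _+_ (∑-0 (states n)) (∑-0 (states n)))))

  !-stripStep : ∀ (t : Tree n) x → stripStep t ! x ≡ transfer (t !_) x
  !-stripStep {n} t x = begin
    stripStep t ! x
      ≡⟨ !-⊕ (ascend false (descend false t)) _ x ⟩
    ascend false (descend false t) ! x + ascend true (descend true t) ! x
      ≡⟨ cong₂ _+_ (half false) (half true) ⟩
    (∑ (states n) λ y → path ok false x y * down (t !_) (false ∷ y)) + (∑ (states n) λ y → path ok true x y * down (t !_) (true ∷ y))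
      ≡⟨ ∑-bits n ⟨
    transfer (t !_) x ∎
    where
    open ≡-Reasoning
    half : ∀ b → ascend b (descend b t) ! x ≡ ∑ (states n) λ y → path ok b x y * down (t !_) (b ∷ y)
    half b = trans (!-ascend b (descend b t) x) (∑-cong (states n) λ y → cong (path ok b x y *_) (!-descend b t y))

  ∑-endingIn : ∀ b (t : Tree (suc n)) {F : Vec Bool (suc n) → ℕ} →
    (∑ (states (suc n)) λ x → F x * endingIn b t ! x) ≡ ∑ (states n) λ x → F (x ∷ʳ b) * t ! (x ∷ʳ b)
  ∑-endingIn false (node (leaf a) (leaf b)) {F} = cong (F (false ∷ []) * a +_) (trans (+-identityʳ _) (*-zeroʳ (F (true ∷ []))))
  ∑-endingIn true  (node (leaf a) (leaf b)) {F} = cong (_+ (F (true ∷ []) * b + 0)) (*-zeroʳ (F (false ∷ [])))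
  ∑-endingIn {n = suc n} false (node s@(node _ _) t@(node _ _)) {F} = trans (∑-bits (suc n)) (trans
    (cong₂ _+_ (∑-endingIn false s {λ x → F (false ∷ x)}) (∑-endingIn false t {λ x → F (true ∷ x)})) (sym (∑-bits n)))
  ∑-endingIn {n = suc n} true (node s@(node _ _) t@(node _ _)) {F} = trans (∑-bits (suc n)) (trans
    (cong₂ _+_ (∑-endingIn true s {λ x → F (false ∷ x)}) (∑-endingIn true t {λ x → F (true ∷ x)})) (sym (∑-bits n)))

  !-cylinderStep : ∀ (t : Tree (suc n)) γ → cylinderStep t ! γ ≡ Cylinder.rowTransfer n (t !_) γ
  !-cylinderStep {n} t γ = begin
    cylinderStep t ! γ
      ≡⟨ !-⊕ (ascend false (endingIn false (descend false t))) _ γ ⟩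
    ascend false (endingIn false (descend false t)) ! γ + ascend true (endingIn true (descend true t)) ! γ
      ≡⟨ cong₂ _+_ (half false) (half true) ⟩
    (∑ (states n) λ β → path ok false γ (β ∷ʳ false) * rowDown (t !_) (false ∷ β))
      + (∑ (states n) λ β → path ok true γ (β ∷ʳ true) * rowDown (t !_) (true ∷ β))
      ≡⟨ ∑-bits n ⟨
    rowTransfer (t !_) γ ∎
    where
    open ≡-Reasoning
    open Cylinder n
    half : ∀ b → ascend b (endingIn b (descend b t)) ! γ ≡
           ∑ (states n) λ β → path ok b γ (β ∷ʳ b) * rowDown (t !_) (b ∷ β)
    half b = trans (!-ascend b (endingIn b (descend b t)) γ) (trans (∑-endingIn b (descend b t) {path ok b γ})
      (∑-cong (states n) λ β → cong (path ok b γ (β ∷ʳ b) *_) (!-descend b t (β ∷ʳ b))))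

  -- The hypotheses of `collatz-wielandt` as a Boolean, so that on closed trees they are checked by
  -- evaluation.
  dominates : ℕ → ℕ → Tree n → Tree n → Bool
  dominates D N (leaf a)   (leaf b)     = (0 <ᵇ b) ∧ (D * a ≤ᵇ N * b)
  dominates D N (node s t) (node s′ t′) = dominates D N s s′ ∧ dominates D N t t′

  dominates-sound : ∀ D N (s t : Tree n) → T (dominates D N s t) → ∀ x → 1 ≤ t ! x × D * s ! x ≤ N * t ! x
  dominates-sound D N (leaf a)   (leaf b)     d []          =
    let p , q = Equivalence.to T-∧ d in <ᵇ⇒< 0 b p , ≤ᵇ⇒≤ (D * a) (N * b) q
  dominates-sound D N (node s t) (node s′ t′) d (false ∷ x) = dominates-sound D N s s′ (proj₁ (Equivalence.to T-∧ d)) x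
  dominates-sound D N (node s t) (node s′ t′) d (true ∷ x)  =
    dominates-sound D N t t′ (proj₂ (Equivalence.to (T-∧ {dominates D N s s′}) d)) x

  f-upper : ∀ D N (v : Tree n) → T (dominates D N (stripStep v) v) →
    ∀ m → f m n * D ^ m ≤ total v * N ^ m
  f-upper {n} D N v d m = subst₂ _≤_ (cong (_* D ^ m) (sym (f-extensions m n))) (cong (_* N ^ m) (sym (total-∑ v)))
    (total-bound (states n) (states (suc n)) compat D N (v !_) (λ x → proj₁ (sound x))
      (λ x → subst (λ z → D * z ≤ N * v ! x) (!-stripStep v x) (proj₂ (sound x))) m)
    where sound = dominates-sound D N (stripStep v) v d

  trace-upper : ∀ D N (v : Tree (suc n)) → T (dominates D N (cylinderStep v) v) →
    ∀ m → trace n m * D ^ m ≤ total v * N ^ m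
  trace-upper {n} D N v d m = subst₂ _≤_ (cong (_* D ^ m) (sym (trace-rows m))) (cong (_* N ^ m) (sym (total-∑ v)))
    (total-bound (states (suc n)) (states (suc n)) (λ γ β → weight ok β γ) D N (v !_) (λ x → proj₁ (sound x))
      (λ x → subst (λ z → D * z ≤ N * v ! x) (!-cylinderStep v x) (proj₂ (sound x))) m)
    where
    open Cylinder n
    sound = dominates-sound D N (cylinderStep v) v d

  -- Power iteration from the constant vector. The totals are values of f, and the vectors, tending
  -- in direction to the leading eigenvector, serve as test vectors in the upper bound.
  stripSteps : ℕ → ∀ n → Tree n
  stripSteps m n = fold (constant 1 n) stripStep m

  f-total : ∀ m n → f m n ≡ total (stripSteps m n)
  f-total m n = trans (f-extensions m n) (trans (∑-cong (states n) (λ x → sym (go m x))) (sym (total-∑ (stripSteps m n))))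
    where
    go : ∀ m x → stripSteps m n ! x ≡ extensions m x
    go zero    x = !-constant 1 x
    go (suc m) x = trans (!-stripStep (stripSteps m n) x) (transfer-cong (go m) x)

  growsBy : ℕ → ℕ → Tree n → Bool
  growsBy D N v = N * total v ≤ᵇ D * total (stripStep v)

  -- By log-convexity the successive ratios of f never decrease, so a lower bound N / D on the first
  -- one yields geometric growth.
  f-grows : ∀ D N m n → N * f m n ≤ D * f (suc m) n → ∀ j → N ^ j ≤ f (j + m) n * D ^ j
  f-grows D N m n base zero    = ≤-trans (f-pos m n) (≤-reflexive (sym (*-identityʳ _)))
  f-grows D N m n base (suc j) = begin
    N * N ^ j                       ≤⟨ *-monoʳ-≤ N (f-grows D N m n base j) ⟩
    N * (f (j + m) n * D ^ j)       ≡⟨ *-assoc N _ _ ⟨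
    N * f (j + m) n * D ^ j         ≤⟨ *-monoˡ-≤ (D ^ j) (step j) ⟩
    D * f (suc j + m) n * D ^ j     ≡⟨ lem D _ (D ^ j) ⟩
    f (suc j + m) n * D ^ suc j     ∎
    where
    open ≤-Reasoning
    lem : ∀ a b c → a * b * c ≡ b * (a * c)
    lem = solve-∀
    step : ∀ j → N * f (j + m) n ≤ D * f (suc j + m) n
    step zero    = base
    step (suc j) = *-cancelʳ-≤ _ _ (f (suc j + m) n) {{>-nonZero (f-pos (suc j + m) n)}} (begin
      N * f (suc j + m) n * f (suc j + m) n    ≡⟨ *-assoc N _ _ ⟩
      N * f (suc j + m) n ²                    ≤⟨ *-monoʳ-≤ N (f-logConvex (j + m) n) ⟩
      N * (f (j + m) n * f (2 + j + m) n)      ≡⟨ *-assoc N _ _ ⟨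
      N * f (j + m) n * f (2 + j + m) n        ≤⟨ *-monoˡ-≤ (f (2 + j + m) n) (step j) ⟩
      D * f (suc j + m) n * f (2 + j + m) n    ≡⟨ lem′ D (f (suc j + m) n) (f (2 + j + m) n) ⟩
      D * f (2 + j + m) n * f (suc j + m) n    ∎)
      where
      lem′ : ∀ a b c → a * b * c ≡ a * c * b
      lem′ = solve-∀

  f-lower : ∀ D N m n → T (growsBy D N (stripSteps m n)) → ∀ j → N ^ j ≤ f (j + m) n * D ^ j
  f-lower D N m n g = f-grows D N m n
    (subst₂ (λ a b → N * a ≤ D * b) (sym (f-total m n)) (sym (f-total (suc m) n)) (≤ᵇ⇒≤ _ _ g))

  -- The largest eigenvalues are 6402.6838… for strip₁₀ and 3463.05307… for
  -- cylinder₂₀, where little room is left below 1.503048372²⁰ = 3463.0530996….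
  -- In strip₁₁, 14464.59 is just below f 13 11 / f 12 11.
  cylinderSteps : ℕ → Tree 10
  cylinderSteps = fold (constant 1 10) cylinderStep

  opaque
    strip₁₀ : ∃ λ C → ∀ m → f m 10 * 10000 ^ m ≤ C * 64026975 ^ m
    strip₁₀ = total (stripSteps 12 10) , f-upper 10000 64026975 (stripSteps 12 10) tt

    strip₁₁ : ∀ j → 1446459 ^ j ≤ f (j + 12) 11 * 100 ^ j
    strip₁₁ = f-lower 100 1446459 12 11 tt

    cylinder₂₀ : ∃ λ C → ∀ m → trace 9 m * 1000000 ^ m ≤ C * 3463053095 ^ m
    cylinder₂₀ = total (cylinderSteps 18) , trace-upper 1000000 3463053095 (cylinderSteps 18) tt

-- From eigenvalue bounds to growth rates of f.

module Rates where

  open Sums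
  open Columns
  open Rows
  open Growth
  open Tables
  open import Defs using (f; order)
  open import Data.Nat.Base
  open import Data.Nat.Properties
  open import Data.Nat.Tactic.RingSolver using (solve-∀)
  open import Data.Product using (∃; ∃₂; _×_; _,_; proj₁; proj₂)
  open import Data.Unit.Base using (tt)
  open import Relation.Binary.PropositionalEquality

  -- Upper and lower bounds p / q on f ^ (1 / order), up to a factor C ^ ((m + n) / order) that
  -- becomes negligible. Some arbitrarily large rectangles are enough, as the limit exists.
  AtMost AtLeast : ℕ → ℕ → Set
  AtMost p q = ∃ λ C → ∀ i → ∃₂ λ m n → i ≤ m × i ≤ n ×
    f m n * q ^ order m n ≤ C ^ (m + n) * p ^ order m n
  AtLeast p q = ∃ λ C → ∀ i → ∃₂ λ m n → i ≤ m × i ≤ n ×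
    p ^ order m n ≤ C ^ (m + n) * (f m n * q ^ order m n)

  module _ (p q D N : ℕ) .{{_ : NonZero D}} (q≤p : q ≤ p) (rate : N * q ^ 20 ≤ D * p ^ 20) (C : ℕ)
    (bound : ∀ n → trace 9 n * D ^ n ≤ C * N ^ n) where

    private
      X = 2 + C

      -- By `f-trace`, f is bounded by j cylinders of circumference 20 and height n, each growing at
      -- rate N / D ≤ (p / q)²⁰ in n. The base `X` covers both C ^ j and 2 ^ n.
      ends : ∀ j n → f (j * 5 + j * 5) n * (q ^ 20) ^ (n * j) ≤ X ^ j * X ^ n * (p ^ 20) ^ (n * j)
      ends j n = *-cancelʳ-≤ _ _ (D ^ (n * j)) {{m^n≢0 D (n * j)}} (begin
        f (j * 5 + j * 5) n * (q ^ 20) ^ (n * j) * D ^ (n * j)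
          ≤⟨ *-monoˡ-≤ (D ^ (n * j)) (*-monoˡ-≤ ((q ^ 20) ^ (n * j)) (f-trace 4 j n)) ⟩
        trace 9 n ^ j * 2 ^ n * (q ^ 20) ^ (n * j) * D ^ (n * j)
          ≡⟨ cong (trace 9 n ^ j * 2 ^ n * (q ^ 20) ^ (n * j) *_) (sym (^-*-assoc D n j)) ⟩
        trace 9 n ^ j * 2 ^ n * (q ^ 20) ^ (n * j) * (D ^ n) ^ j
          ≡⟨ lem₁ (trace 9 n ^ j) (2 ^ n) ((q ^ 20) ^ (n * j)) ((D ^ n) ^ j) ⟩
        trace 9 n ^ j * (D ^ n) ^ j * (2 ^ n * (q ^ 20) ^ (n * j))
          ≡⟨ cong (_* (2 ^ n * (q ^ 20) ^ (n * j))) (^-distribʳ-* (trace 9 n) (D ^ n) j) ⟨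
        (trace 9 n * D ^ n) ^ j * (2 ^ n * (q ^ 20) ^ (n * j))
          ≤⟨ *-monoˡ-≤ (2 ^ n * (q ^ 20) ^ (n * j)) (^-monoˡ-≤ j (bound n)) ⟩
        (C * N ^ n) ^ j * (2 ^ n * (q ^ 20) ^ (n * j))
          ≡⟨ cong (_* (2 ^ n * (q ^ 20) ^ (n * j))) (trans (^-distribʳ-* C (N ^ n) j) (cong (C ^ j *_) (^-*-assoc N n j))) ⟩
        C ^ j * N ^ (n * j) * (2 ^ n * (q ^ 20) ^ (n * j))
          ≡⟨ lem₂ (C ^ j) (N ^ (n * j)) (2 ^ n) ((q ^ 20) ^ (n * j)) ⟩
        C ^ j * 2 ^ n * (N ^ (n * j) * (q ^ 20) ^ (n * j))
          ≡⟨ cong (C ^ j * 2 ^ n *_) (^-distribʳ-* N (q ^ 20) (n * j)) ⟨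
        C ^ j * 2 ^ n * (N * q ^ 20) ^ (n * j)
          ≤⟨ *-mono-≤ (*-mono-≤ (^-monoˡ-≤ j (m≤n+m C 2)) (^-monoˡ-≤ n (m≤m+n 2 C))) (^-monoˡ-≤ (n * j) rate) ⟩
        X ^ j * X ^ n * (D * p ^ 20) ^ (n * j)
          ≡⟨ cong (X ^ j * X ^ n *_) (^-distribʳ-* D (p ^ 20) (n * j)) ⟩
        X ^ j * X ^ n * (D ^ (n * j) * (p ^ 20) ^ (n * j))
          ≡⟨ lem₃ (X ^ j * X ^ n) (D ^ (n * j)) ((p ^ 20) ^ (n * j)) ⟩
        X ^ j * X ^ n * (p ^ 20) ^ (n * j) * D ^ (n * j) ∎)
        where
        open ≤-Reasoning
        lem₁ : ∀ a b c d → a * b * c * d ≡ a * d * (b * c)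
        lem₁ = solve-∀
        lem₂ : ∀ a b c d → a * b * (c * d) ≡ a * c * (b * d)
        lem₂ = solve-∀
        lem₃ : ∀ a b c → a * (b * c) ≡ a * c * b
        lem₃ = solve-∀

    -- For m = 10 i and n = i the order is 20 i² + 11 i: `ends` treats the quadratic part, and q ≤ p
    -- the linear one.
    atMost : AtMost p q
    atMost = X , λ i → i * 5 + i * 5 , i , ≤-trans (m≤m*n i 5) (m≤m+n (i * 5) (i * 5)) , ≤-refl , at i
      where
      at : ∀ i → let m = i * 5 + i * 5 in f m i * q ^ order m i ≤ X ^ (m + i) * p ^ order m i
      at i = begin
        f m i * q ^ order m i
          ≡⟨ cong (λ k → f m i * k) (split q) ⟩
        f m i * ((q ^ 20) ^ (i * i) * q ^ (m + i))
          ≡⟨ *-assoc (f m i) ((q ^ 20) ^ (i * i)) (q ^ (m + i)) ⟨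
        f m i * (q ^ 20) ^ (i * i) * q ^ (m + i)
          ≤⟨ *-mono-≤ (ends i i) (^-monoˡ-≤ (m + i) q≤p) ⟩
        X ^ i * X ^ i * (p ^ 20) ^ (i * i) * p ^ (m + i)
          ≤⟨ *-monoˡ-≤ (p ^ (m + i)) (*-monoˡ-≤ ((p ^ 20) ^ (i * i)) (*-monoˡ-≤ (X ^ i)
               (^-monoʳ-≤ X (≤-trans (m≤m*n i 5) (m≤m+n (i * 5) (i * 5)))))) ⟩
        X ^ m * X ^ i * (p ^ 20) ^ (i * i) * p ^ (m + i)
          ≡⟨ trans (*-assoc (X ^ m * X ^ i) ((p ^ 20) ^ (i * i)) (p ^ (m + i)))
               (cong₂ _*_ (sym (^-distribˡ-+-* X m i)) (sym (split p))) ⟩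
        X ^ (m + i) * p ^ order m i ∎
        where
        open ≤-Reasoning
        m = i * 5 + i * 5
        expand : ∀ i → 2 * (i * 5 + i * 5) * i + (i * 5 + i * 5) + i ≡ 20 * (i * i) + (i * 5 + i * 5 + i)
        expand = solve-∀
        split : ∀ r → r ^ order m i ≡ (r ^ 20) ^ (i * i) * r ^ (m + i)
        split r = trans (cong (r ^_) (expand i)) (trans (^-distribˡ-+-* r (20 * (i * i)) (m + i))
          (cong (_* r ^ (m + i)) (sym (^-*-assoc r 20 (i * i)))))

  module _ (p q α a β b : ℕ) .{{_ : NonZero p}} .{{_ : NonZero q}} .{{_ : NonZero a}} .{{_ : NonZero b}} .{{_ : NonZero β}}
    (rate : p ^ 2 * (a * β) ≤ α * b * q ^ 2) (C : ℕ)
    (narrow : ∀ n → f n 10 * b ^ n ≤ C * β ^ n) (wide : ∀ j → α ^ j ≤ f (j + 12) 11 * a ^ j) where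

    private
      Y = C * β ^ 12

      -- Log-convexity gives f (k + 10) n ≥ (f 11 n / f 10 n)ᵏ, where f 11 n grows in n at least at
      -- rate α / a and f 10 n at most at rate β / b. The factor β ^ 12 in `Y` pays for the offset n
      -- = j + 12.
      growth-rate : ∀ j k → (α * b) ^ (j * k) ≤ f (k + 10) (j + 12) * Y ^ k * (a * β) ^ (j * k)
      growth-rate j k = begin
        (α * b) ^ (j * k)
          ≡⟨ ^-*-assoc (α * b) j k ⟨
        ((α * b) ^ j) ^ k
          ≤⟨ ^-monoˡ-≤ k (begin
               (α * b) ^ j                          ≡⟨ ^-distribʳ-* α b j ⟩
               α ^ j * b ^ j                        ≤⟨ *-mono-≤ (wide j) (^-monoʳ-≤ b (m≤m+n j 12)) ⟩
               f n 11 * a ^ j * b ^ n               ≡⟨ cong (λ z → z * a ^ j * b ^ n) (f-sym n 11) ⟩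
               f 11 n * a ^ j * b ^ n               ∎) ⟩
        (f 11 n * a ^ j * b ^ n) ^ k
          ≡⟨ trans (^-distribʳ-* (f 11 n * a ^ j) (b ^ n) k) (cong (_* (b ^ n) ^ k) (^-distribʳ-* (f 11 n) (a ^ j) k)) ⟩
        f 11 n ^ k * (a ^ j) ^ k * (b ^ n) ^ k
          ≤⟨ *-monoˡ-≤ ((b ^ n) ^ k) (*-monoˡ-≤ ((a ^ j) ^ k)
               (f-grows (f 10 n) (f 11 n) 10 n (≤-reflexive (*-comm (f 11 n) (f 10 n))) k)) ⟩
        f (k + 10) n * f 10 n ^ k * (a ^ j) ^ k * (b ^ n) ^ k
          ≡⟨ lem₁ (f (k + 10) n) (f 10 n ^ k) ((a ^ j) ^ k) ((b ^ n) ^ k) ⟩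
        f (k + 10) n * ((a ^ j) ^ k * (f 10 n ^ k * (b ^ n) ^ k))
          ≡⟨ cong (λ z → f (k + 10) n * ((a ^ j) ^ k * z)) (trans (sym (^-distribʳ-* (f 10 n) (b ^ n) k))
               (cong (λ z → (z * b ^ n) ^ k) (f-sym 10 n))) ⟩
        f (k + 10) n * ((a ^ j) ^ k * (f n 10 * b ^ n) ^ k)
          ≤⟨ *-monoʳ-≤ (f (k + 10) n) (*-monoʳ-≤ ((a ^ j) ^ k) (^-monoˡ-≤ k (narrow n))) ⟩
        f (k + 10) n * ((a ^ j) ^ k * (C * β ^ n) ^ k)
          ≡⟨ cong (λ z → f (k + 10) n * ((a ^ j) ^ k * z ^ k))
               (trans (cong (C *_) (^-distribˡ-+-* β j 12)) (lem₂ C (β ^ j) (β ^ 12))) ⟩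
        f (k + 10) n * ((a ^ j) ^ k * (Y * β ^ j) ^ k)
          ≡⟨ cong (f (k + 10) n *_) (trans (sym (^-distribʳ-* (a ^ j) (Y * β ^ j) k))
               (trans (cong (_^ k) (trans (lem₃ (a ^ j) Y (β ^ j)) (cong (Y *_) (sym (^-distribʳ-* a β j)))))
                 (trans (^-distribʳ-* Y ((a * β) ^ j) k) (cong (Y ^ k *_) (^-*-assoc (a * β) j k))))) ⟩
        f (k + 10) n * (Y ^ k * (a * β) ^ (j * k))
          ≡⟨ *-assoc (f (k + 10) n) (Y ^ k) _ ⟨
        f (k + 10) n * Y ^ k * (a * β) ^ (j * k) ∎
        where
        open ≤-Reasoning
        n = j + 12
        lem₁ : ∀ x y z w → x * y * z * w ≡ x * (z * (y * w))
        lem₁ = solve-∀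
        lem₂ : ∀ x y z → x * (y * z) ≡ x * z * y
        lem₂ = solve-∀
        lem₃ : ∀ x y z → x * (y * z) ≡ y * (x * z)
        lem₃ = solve-∀

      bulk : ∀ j k → p ^ (2 * (j * k)) ≤ f (k + 10) (j + 12) * Y ^ k * q ^ (2 * (j * k))
      bulk j k = *-cancelʳ-≤ _ _ ((a * β) ^ (j * k)) {{m^n≢0 (a * β) (j * k) {{m*n≢0 a β}}}} (begin
        p ^ (2 * (j * k)) * (a * β) ^ (j * k)
          ≡⟨ trans (cong (_* (a * β) ^ (j * k)) (sym (^-*-assoc p 2 (j * k)))) (sym (^-distribʳ-* (p ^ 2) (a * β) (j * k))) ⟩
        (p ^ 2 * (a * β)) ^ (j * k)
          ≤⟨ ^-monoˡ-≤ (j * k) rate ⟩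
        (α * b * q ^ 2) ^ (j * k)
          ≡⟨ trans (^-distribʳ-* (α * b) (q ^ 2) (j * k)) (cong ((α * b) ^ (j * k) *_) (^-*-assoc q 2 (j * k))) ⟩
        (α * b) ^ (j * k) * q ^ (2 * (j * k))
          ≤⟨ *-monoˡ-≤ (q ^ (2 * (j * k))) (growth-rate j k) ⟩
        f (k + 10) (j + 12) * Y ^ k * (a * β) ^ (j * k) * q ^ (2 * (j * k))
          ≡⟨ lem (f (k + 10) (j + 12) * Y ^ k) ((a * β) ^ (j * k)) (q ^ (2 * (j * k))) ⟩
        f (k + 10) (j + 12) * Y ^ k * q ^ (2 * (j * k)) * (a * β) ^ (j * k) ∎)
        where
        open ≤-Reasoning
        lem : ∀ x y z → x * y * z ≡ x * z * y
        lem = solve-∀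

    atLeast : AtLeast p q
    -- The order is 2 i² + 46 i + 262, whose non-quadratic part is at most 25 (m + n) = 50 i + 550;
    -- hence p ^ 25. The successor keeps the base positive, for monotonicity in the exponent.
    atLeast = suc Y * p ^ 25 , λ i → i + 10 , i + 12 , m≤m+n i 10 , m≤m+n i 12 , at i
      where
      at : ∀ i → let m = i + 10; n = i + 12 in p ^ order m n ≤ (suc Y * p ^ 25) ^ (m + n) * (f m n * q ^ order m n)
      at i = begin
        p ^ order m n
          ≡⟨ cong (p ^_) (expand i) ⟩
        p ^ (2 * (i * i) + r)
          ≡⟨ ^-distribˡ-+-* p (2 * (i * i)) r ⟩
        p ^ (2 * (i * i)) * p ^ r
          ≤⟨ *-mono-≤ (bulk i i) (^-monoʳ-≤ p r≤) ⟩
        f m n * Y ^ i * q ^ (2 * (i * i)) * p ^ (25 * (m + n))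
          ≤⟨ *-monoˡ-≤ (p ^ (25 * (m + n))) (*-mono-≤ (*-monoʳ-≤ (f m n)
               (≤-trans (^-monoˡ-≤ i (n≤1+n Y)) (^-monoʳ-≤ (suc Y) (≤-trans (m≤m+n i 10) (m≤m+n m n)))))
               (^-monoʳ-≤ q (subst (2 * (i * i) ≤_) (sym (expand i)) (m≤m+n (2 * (i * i)) r)))) ⟩
        f m n * suc Y ^ (m + n) * q ^ order m n * p ^ (25 * (m + n))
          ≡⟨ lem (f m n) (suc Y ^ (m + n)) (q ^ order m n) (p ^ (25 * (m + n))) ⟩
        suc Y ^ (m + n) * p ^ (25 * (m + n)) * (f m n * q ^ order m n)
          ≡⟨ cong (_* (f m n * q ^ order m n)) (trans (cong (suc Y ^ (m + n) *_) (sym (^-*-assoc p 25 (m + n))))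
               (sym (^-distribʳ-* (suc Y) (p ^ 25) (m + n)))) ⟩
        (suc Y * p ^ 25) ^ (m + n) * (f m n * q ^ order m n) ∎
        where
        open ≤-Reasoning
        m = i + 10
        n = i + 12
        r = 46 * i + 262
        expand : ∀ i → 2 * (i + 10) * (i + 12) + (i + 10) + (i + 12) ≡ 2 * (i * i) + (46 * i + 262)
        expand = solve-∀
        more : ∀ i → 46 * i + 262 + (4 * i + 288) ≡ 25 * (i + 10 + (i + 12))
        more = solve-∀
        r≤ : r ≤ 25 * (m + n)
        r≤ = subst (r ≤_) (more i) (m≤m+n r (4 * i + 288))
        lem : ∀ x y z w → x * y * z * w ≡ y * w * (x * z)
        lem = solve-∀

  opaque
    -- The closing comparison is 3463.053095 ≤ 1.503048372²⁰.
    f-atMost : AtMost 1503048372 1000000000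
    f-atMost = atMost 1503048372 1000000000 1000000 3463053095 (≤ᵇ⇒≤ _ _ tt)
      (≤ᵇ⇒≤ (3463053095 * 1000000000 ^ 20) (1000000 * 1503048372 ^ 20) tt) (proj₁ cylinder₂₀) (proj₂ cylinder₂₀)

    -- The closing comparison is 1.503041110² ≤ 14464.59 / 6402.6975.
    f-atLeast : AtLeast 1503041110 1000000000
    f-atLeast = atLeast 1503041110 1000000000 1446459 100 64026975 10000
      (≤ᵇ⇒≤ (1503041110 ^ 2 * (100 * 64026975)) (1446459 * 10000 * 1000000000 ^ 2) tt) (proj₁ strip₁₀) (proj₂ strip₁₀) strip₁₁

-- Powers of rationals and exponential growth.

module Rational where

  open import Defs using (fromℕ; _^_)
  open import Data.Integer.Base as ℤ using (ℤ; +_; -[1+_]; +≤+; +<+)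
  import Data.Integer.Properties as ℤ
  open import Data.Nat.Base as ℕ using (ℕ; zero; suc; z≤n; s≤s)
  import Data.Nat.Properties as ℕ
  open import Data.Product using (∃; _,_; proj₁; proj₂)
  open import Data.Rational.Base hiding (∣_∣)
  open import Data.Rational.Properties
  open import Data.Rational.Solver using (module +-*-Solver)
  open import Data.Rational.Unnormalised.Base as ℚᵘ using (ℚᵘ; mkℚᵘ; *≡*; *≤*; *<*)
  import Data.Rational.Unnormalised.Properties as ℚᵘ
  open import Algebra.Bundles using (CommutativeRing)
  open import Relation.Binary.PropositionalEquality
  open import Relation.Nullary using (yes; no; contradiction)
  import Algebra.Properties.Semiring.Exp (CommutativeRing.semiring +-*-commutativeRing) as Exp
  import Algebra.Properties.CommutativeSemiring.Exp (CommutativeRing.commutativeSemiring +-*-commutativeRing) as CExp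
  open +-*-Solver using (solve; _:+_; _:*_; _:-_; :-_; _:=_; con)

  0≤1 : 0ℚ ≤ 1ℚ
  0≤1 = <⇒≤ (positive⁻¹ 1ℚ)

  infixl 7 _*⁺_ _*⁰_
  _*⁺_ : ∀ {p q} → 0ℚ < p → 0ℚ < q → 0ℚ < p * q
  _*⁺_ {p} {q} 0<p 0<q = positive⁻¹ (p * q) {{pos*pos⇒pos p {{positive 0<p}} q {{positive 0<q}}}}

  _*⁰_ : ∀ {p q} → 0ℚ ≤ p → 0ℚ ≤ q → 0ℚ ≤ p * q
  _*⁰_ {p} {q} 0≤p 0≤q = nonNegative⁻¹ (p * q) {{nonNeg*nonNeg⇒nonNeg p {{nonNegative 0≤p}} q {{nonNegative 0≤q}}}}

  *-monoˡ : ∀ r {p q} → 0ℚ ≤ r → p ≤ q → r * p ≤ r * q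
  *-monoˡ r 0≤r = *-monoˡ-≤-nonNeg r {{nonNegative 0≤r}}

  *-monoʳ : ∀ r {p q} → 0ℚ ≤ r → p ≤ q → p * r ≤ q * r
  *-monoʳ r 0≤r = *-monoʳ-≤-nonNeg r {{nonNegative 0≤r}}

  p<p+q : ∀ p {q} → 0ℚ < q → p < p + q
  p<p+q p {q} 0<q = subst (_< p + q) (+-identityʳ p) (+-monoʳ-< p 0<q)

  p≤p+q : ∀ p {q} → 0ℚ ≤ q → p ≤ p + q
  p≤p+q p {q} 0≤q = subst (_≤ p + q) (+-identityʳ p) (+-monoʳ-≤ p 0≤q)

  p<q⇒0<q-p : ∀ {p q} → p < q → 0ℚ < q - p
  p<q⇒0<q-p {p} {q} p<q = subst (_< q - p) (+-inverseʳ p) (+-monoˡ-< (- p) p<q)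

  ^-nonNeg : ∀ {q} k → 0ℚ ≤ q → 0ℚ ≤ q ^ k
  ^-nonNeg zero    0≤q = 0≤1
  ^-nonNeg (suc k) 0≤q = 0≤q *⁰ ^-nonNeg k 0≤q

  ^-pos : ∀ {q} k → 0ℚ < q → 0ℚ < q ^ k
  ^-pos zero    0<q = positive⁻¹ 1ℚ
  ^-pos (suc k) 0<q = 0<q *⁺ ^-pos k 0<q

  ^-mono-≤ : ∀ k {p q} → 0ℚ ≤ p → p ≤ q → p ^ k ≤ q ^ k
  ^-mono-≤ zero    0≤p p≤q = ≤-refl
  ^-mono-≤ (suc k) {p} {q} 0≤p p≤q = ≤-trans
    (*-monoˡ p 0≤p (^-mono-≤ k 0≤p p≤q)) (*-monoʳ (q ^ k) (^-nonNeg k (≤-trans 0≤p p≤q)) p≤q)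

  ^-mono-< : ∀ k .{{_ : ℕ.NonZero k}} {p q} → 0ℚ ≤ p → p < q → p ^ k < q ^ k
  ^-mono-< (suc k) {p} {q} 0≤p p<q = ≤-<-trans
    (*-monoˡ p 0≤p (^-mono-≤ k 0≤p (<⇒≤ p<q)))
    (*-monoˡ-<-pos (q ^ k) {{positive (^-pos k (≤-<-trans 0≤p p<q))}} p<q)

  ^-cancel-≤ : ∀ k .{{_ : ℕ.NonZero k}} {p q} → 0ℚ ≤ q → p ^ k ≤ q ^ k → p ≤ q
  ^-cancel-≤ k {p} {q} 0≤q le with p ≤? q
  ... | yes p≤q = p≤q
  ... | no  p≰q = contradiction (<-≤-trans (^-mono-< k 0≤q (≰⇒> p≰q)) le) (<-irrefl refl)

  ^-cancel-< : ∀ k {p q} → 0ℚ ≤ q → p ^ k < q ^ k → p < q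
  ^-cancel-< k {p} {q} 0≤q lt with p <? q
  ... | yes p<q = p<q
  ... | no  p≮q = contradiction (<-≤-trans lt (^-mono-≤ k 0≤q (≮⇒≥ p≮q))) (<-irrefl refl)

  1^ : ∀ k → 1ℚ ^ k ≡ 1ℚ
  1^ zero    = refl
  1^ (suc k) = trans (*-identityˡ (1ℚ ^ k)) (1^ k)

  ^-homo-* : ∀ x m n → x ^ (m ℕ.+ n) ≡ x ^ m * x ^ n
  ^-homo-* = Exp.^-homo-*

  ^-assoc : ∀ x m n → (x ^ m) ^ n ≡ x ^ (m ℕ.* n)
  ^-assoc = Exp.^-assocʳ

  ^-distrib-* : ∀ x y n → (x * y) ^ n ≡ x ^ n * y ^ n
  ^-distrib-* = CExp.^-distrib-*

  toℚᵘ-fromℕ : ∀ a → toℚᵘ (fromℕ a) ℚᵘ.≃ mkℚᵘ (+ a) 0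
  toℚᵘ-fromℕ a = toℚᵘ-fromℚᵘ (mkℚᵘ (+ a) 0)

  fromℕ-* : ∀ a b → fromℕ (a ℕ.* b) ≡ fromℕ a * fromℕ b
  fromℕ-* a b = toℚᵘ-injective (ℚᵘ.≃-trans (toℚᵘ-fromℕ (a ℕ.* b)) (ℚᵘ.≃-trans
    (*≡* (cong (ℤ._* ℤ.1ℤ) (ℤ.pos-* a b)))
    (ℚᵘ.≃-sym (ℚᵘ.≃-trans (toℚᵘ-homo-* (fromℕ a) (fromℕ b)) (ℚᵘ.*-cong (toℚᵘ-fromℕ a) (toℚᵘ-fromℕ b))))))

  fromℕ-suc : ∀ a → fromℕ (suc a) ≡ 1ℚ + fromℕ a
  fromℕ-suc a = toℚᵘ-injective (ℚᵘ.≃-trans (toℚᵘ-fromℕ (suc a)) (ℚᵘ.≃-trans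
    (*≡* (cong (λ z → (ℤ.1ℤ ℤ.+ z) ℤ.* ℤ.1ℤ) (sym (ℤ.*-identityʳ (+ a)))))
    (ℚᵘ.≃-sym (ℚᵘ.≃-trans (toℚᵘ-homo-+ 1ℚ (fromℕ a)) (ℚᵘ.+-cong (ℚᵘ.≃-refl {toℚᵘ 1ℚ}) (toℚᵘ-fromℕ a))))))

  fromℕ-^ : ∀ a k → fromℕ (a ℕ.^ k) ≡ fromℕ a ^ k
  fromℕ-^ a zero    = refl
  fromℕ-^ a (suc k) = trans (fromℕ-* a (a ℕ.^ k)) (cong (fromℕ a *_) (fromℕ-^ a k))

  fromℕ-mono : ∀ {a b} → a ℕ.≤ b → fromℕ a ≤ fromℕ b
  fromℕ-mono {a} {b} a≤b = toℚᵘ-cancel-≤ (ℚᵘ.≤-respˡ-≃ (ℚᵘ.≃-sym (toℚᵘ-fromℕ a))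
    (ℚᵘ.≤-respʳ-≃ (ℚᵘ.≃-sym (toℚᵘ-fromℕ b)) (*≤* (ℤ.*-monoʳ-≤-nonNeg ℤ.1ℤ (+≤+ a≤b)))))

  0≤fromℕ : ∀ a → 0ℚ ≤ fromℕ a
  0≤fromℕ a = fromℕ-mono {0} {a} z≤n

  0<fromℕ : ∀ a .{{_ : ℕ.NonZero a}} → 0ℚ < fromℕ a
  0<fromℕ (suc a) = <-≤-trans (positive⁻¹ 1ℚ) (fromℕ-mono {1} {suc a} (s≤s z≤n))

  /-*-fromℕ : ∀ p q .{{_ : ℕ.NonZero q}} → + p / q * fromℕ q ≡ fromℕ p
  /-*-fromℕ p (suc q) = toℚᵘ-injective (ℚᵘ.≃-trans (toℚᵘ-homo-* (+ p / suc q) (fromℕ (suc q)))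
    (ℚᵘ.≃-trans (ℚᵘ.*-cong (toℚᵘ-fromℚᵘ (mkℚᵘ (+ p) q)) (toℚᵘ-fromℕ (suc q)))
      (ℚᵘ.≃-trans (*≡* (ℤ.*-assoc (+ p) (+ suc q) ℤ.1ℤ)) (ℚᵘ.≃-sym (toℚᵘ-fromℕ p)))))

  below-fromℕ : ∀ x → ∃ λ k → x < fromℕ k
  below-fromℕ x@(mkℚ (+ n) d-1 _) = suc n , toℚᵘ-cancel-< (ℚᵘ.<-respʳ-≃ (ℚᵘ.≃-sym (toℚᵘ-fromℕ (suc n)))
    (*<* (subst₂ ℤ._<_ (sym (ℤ.*-identityʳ (+ n))) (ℤ.pos-* (suc n) (suc d-1)) (+<+ (ℕ.m≤m*n (suc n) (suc d-1))))))
  below-fromℕ x@(mkℚ -[1+ n ] d-1 _) = 0 , negative⁻¹ x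

  archimedean : ∀ x {ε} → 0ℚ < ε → ∃ λ k → x < fromℕ k * ε
  archimedean x {ε} 0<ε = let k , lt = below-fromℕ (x * 1/ ε) in k ,
    subst (_< fromℕ k * ε)
      (trans (*-assoc x (1/ ε) ε) (trans (cong (x *_) (*-inverseˡ ε)) (*-identityʳ x)))
      (*-monoˡ-<-pos ε {{positive 0<ε}} lt)
    where instance ε≢0 = pos⇒nonZero ε {{positive 0<ε}}

  q+[r-q]≡r : ∀ q r → q + (r - q) ≡ r
  q+[r-q]≡r = solve 2 (λ q r → q :+ (r :- q) := r) refl

  -- Bernoulli's inequality for (1 + d / q)ʲ, multiplied by qʲ⁺¹ to avoid division.
  bernoulli : ∀ q d → 0ℚ ≤ q → 0ℚ ≤ d → ∀ j → (q + fromℕ j * d) * q ^ j ≤ q * (q + d) ^ j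
  bernoulli q d 0≤q 0≤d zero    = ≤-reflexive (lem₀ q d)
    where
    lem₀ : ∀ q d → (q + 0ℚ * d) * 1ℚ ≡ q * 1ℚ
    lem₀ = solve 2 (λ q d → (q :+ con 0ℚ :* d) :* con 1ℚ := q :* con 1ℚ) refl
  bernoulli q d 0≤q 0≤d (suc j) = begin
    (q + fromℕ (suc j) * d) * (q * q ^ j)
      ≡⟨ cong (λ s → (q + s * d) * (q * q ^ j)) (fromℕ-suc j) ⟩
    (q + (1ℚ + s) * d) * (q * q ^ j)
      ≤⟨ p≤p+q _ (0≤fromℕ j *⁰ (0≤d *⁰ 0≤d) *⁰ ^-nonNeg j 0≤q) ⟩
    (q + (1ℚ + s) * d) * (q * q ^ j) + s * (d * d) * q ^ j
      ≡⟨ lem₁ q d s (q ^ j) ⟩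
    (q + d) * ((q + s * d) * q ^ j)
      ≤⟨ *-monoˡ (q + d) (≤-trans 0≤q (p≤p+q q 0≤d)) (bernoulli q d 0≤q 0≤d j) ⟩
    (q + d) * (q * (q + d) ^ j)
      ≡⟨ lem₂ (q + d) q ((q + d) ^ j) ⟩
    q * (q + d) ^ suc j ∎
    where
    open ≤-Reasoning
    s = fromℕ j
    lem₁ : ∀ q d s z → (q + (1ℚ + s) * d) * (q * z) + s * (d * d) * z ≡ (q + d) * ((q + s * d) * z)
    lem₁ = solve 4 (λ q d s z → (q :+ (con 1ℚ :+ s) :* d) :* (q :* z) :+ s :* (d :* d) :* z := (q :+ d) :* ((q :+ s :* d) :* z)) refl
    lem₂ : ∀ a q z → a * (q * z) ≡ q * (a * z)
    lem₂ = solve 3 (λ a q z → a :* (q :* z) := q :* (a :* z)) refl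

  outgrows : ∀ C {q r} → 0ℚ < q → q < r → ∃ λ i → fromℕ C * q ^ i ≤ r ^ i
  outgrows C {q} {r} 0<q q<r = i , *-cancelˡ-≤-pos q {{positive 0<q}} (begin
    q * (fromℕ C * q ^ i)          ≡⟨ lem q (fromℕ C) (q ^ i) ⟩
    fromℕ C * q * q ^ i            ≤⟨ *-monoʳ (q ^ i) (^-nonNeg i 0≤q) (≤-trans (<⇒≤ (proj₂ large)) (p≤q+p 0≤q)) ⟩
    (q + fromℕ i * (r - q)) * q ^ i
                                   ≤⟨ bernoulli q (r - q) 0≤q (<⇒≤ (p<q⇒0<q-p q<r)) i ⟩
    q * (q + (r - q)) ^ i          ≡⟨ cong (λ z → q * z ^ i) (q+[r-q]≡r q r) ⟩
    q * r ^ i                      ∎)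
    where
    open ≤-Reasoning
    0≤q = <⇒≤ 0<q
    large = archimedean (fromℕ C * q) (p<q⇒0<q-p q<r)
    i = proj₁ large
    lem : ∀ a b c → a * (b * c) ≡ b * a * c
    lem = solve 3 (λ a b c → a :* (b :* c) := b :* a :* c) refl
    p≤q+p : ∀ {p q} → 0ℚ ≤ q → p ≤ q + p
    p≤q+p {p} {q} 0≤q = subst (p ≤_) (+-comm p q) (p≤p+q p 0≤q)

  -- Absorbs error factors such as C ^ (m + n): the k-th power of the hypothesis uses up i k of the
  -- N factors, and q ≤ r handles the rest.
  outgrows-^ : ∀ C {q r} i k N → 0ℚ ≤ q → q ≤ r → fromℕ C * q ^ i ≤ r ^ i → i ℕ.* k ℕ.≤ N →
    fromℕ C ^ k * q ^ N ≤ r ^ N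
  outgrows-^ C {q} {r} i k N 0≤q q≤r le ik≤N = begin
    fromℕ C ^ k * q ^ N
      ≡⟨ cong (fromℕ C ^ k *_) (split q) ⟩
    fromℕ C ^ k * ((q ^ i) ^ k * q ^ e)
      ≡⟨ *-assoc (fromℕ C ^ k) _ _ ⟨
    fromℕ C ^ k * (q ^ i) ^ k * q ^ e
      ≡⟨ cong (_* q ^ e) (^-distrib-* (fromℕ C) (q ^ i) k) ⟨
    (fromℕ C * q ^ i) ^ k * q ^ e
      ≤⟨ *-monoʳ (q ^ e) (^-nonNeg e 0≤q) (^-mono-≤ k (0≤fromℕ C *⁰ ^-nonNeg i 0≤q) le) ⟩
    (r ^ i) ^ k * q ^ e
      ≤⟨ *-monoˡ ((r ^ i) ^ k) (^-nonNeg k (^-nonNeg i (≤-trans 0≤q q≤r))) (^-mono-≤ e 0≤q q≤r) ⟩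
    (r ^ i) ^ k * r ^ e
      ≡⟨ split r ⟨
    r ^ N ∎
    where
    open ≤-Reasoning
    e = N ℕ.∸ i ℕ.* k
    split : ∀ x → x ^ N ≡ (x ^ i) ^ k * x ^ e
    split x = trans (cong (x ^_) (sym (ℕ.m+[n∸m]≡n ik≤N)))
      (trans (^-homo-* x (i ℕ.* k) e) (cong (_* x ^ e) (sym (^-assoc x i k))))

-- Limits of Cauchy families of Dedekind reals.

module Limits where

  open Rational
  open import Defs
  open import Data.Integer.Base using (+_)
  open import Data.Nat.Base as ℕ using (ℕ; zero; suc)
  import Data.Nat.Properties as ℕ
  open import Data.Product using (∃; _×_; _,_; proj₁; proj₂)
  open import Data.Rational.Base hiding (∣_∣)
  open import Data.Rational.Properties
  open import Data.Rational.Solver using (module +-*-Solver)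
  open import Data.Sum.Base using (_⊎_; inj₁; inj₂; [_,_]′)
  open import Relation.Binary.PropositionalEquality
  open import Relation.Nullary using (contradiction)
  open +-*-Solver using (solve; _:+_; _:*_; _:-_; :-_; _:=_; con)
  open ℝ

  private
    p≡p-q+q : ∀ p q → p ≡ p - q + q
    p≡p-q+q = solve 2 (λ p q → p := p :- q :+ q) refl

    p≡p+q-q : ∀ p q → p ≡ p + q - q
    p≡p+q-q = solve 2 (λ p q → p := p :+ q :- q) refl

    p+ε≡halves : ∀ p ε → p + ε ≡ p + ½ * ε + ½ * ε
    p+ε≡halves = solve 2 (λ p ε → p :+ ε := p :+ con ½ :* ε :+ con ½ :* ε) refl

    p-ε≡halves : ∀ p ε → p - ε ≡ p - ½ * ε - ½ * ε
    p-ε≡halves = solve 2 (λ p ε → p :- ε := p :- con ½ :* ε :- con ½ :* ε) refl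

    q-p<q : ∀ q {p} → 0ℚ < p → q - p < q
    q-p<q q {p} 0<p = subst (q - p <_) (sym (p≡p-q+q q p)) (p<p+q (q - p) 0<p)

    next : ∀ l s ε → l + (1ℚ + s) * ε ≡ l + ε + s * ε
    next = solve 3 (λ l s ε → l :+ (con 1ℚ :+ s) :* ε := l :+ ε :+ s :* ε) refl

    start : ∀ l ε → l + 0ℚ * ε ≡ l
    start = solve 2 (λ l ε → l :+ con 0ℚ :* ε := l) refl

    -3ε+2ε : ∀ q ε → q - ε - ε - ε + ε + ε ≡ q - ε
    -3ε+2ε = solve 2 (λ q ε → q :- ε :- ε :- ε :+ ε :+ ε := q :- ε) refl

  ⅛ : ℚ
  ⅛ = + 1 / 8

  private
    8*⅛ : ∀ ε → ε ≡ ⅛ * ε + ⅛ * ε + ⅛ * ε + ⅛ * ε + ⅛ * ε + ⅛ * ε + ⅛ * ε + ⅛ * ε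
    8*⅛ = solve 1 (λ ε → let e = con ⅛ :* ε in ε := e :+ e :+ e :+ e :+ e :+ e :+ e :+ e) refl

    gap-eq : ∀ p e → p + e + e + (e + e + e) ≡ p + (e + e + e + e + e + e + e + e) - e - e - e
    gap-eq = solve 2 (λ p e → p :+ e :+ e :+ (e :+ e :+ e) := p :+ (e :+ e :+ e :+ e :+ e :+ e :+ e :+ e) :- e :- e :- e) refl

    lower-eq : ∀ q e → q - e - (e + e + e + e) ≡ q + e + e - (e + e + e + e + e + e + e + e) + e
    lower-eq = solve 2 (λ q e → q :- e :- (e :+ e :+ e :+ e) := q :+ e :+ e :- (e :+ e :+ e :+ e :+ e :+ e :+ e :+ e) :+ e) refl

    upper-eq : ∀ q e → q - (e + e + e) ≡ q + e + e + e + e + e - (e + e + e + e + e + e + e + e)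
    upper-eq = solve 2 (λ q e → q :- (e :+ e :+ e) := q :+ e :+ e :+ e :+ e :+ e :- (e :+ e :+ e :+ e :+ e :+ e :+ e :+ e)) refl

  -- Walks up from a lower bound in steps of ε, each time locating x relative to l + ε and l + 2 ε.
  -- A known upper bound limits the number of steps, and exhausting them contradicts disjointness.
  approximate : ∀ x {ε} → 0ℚ < ε → ∃ λ q → L x q × U x (q + ε + ε)
  approximate x {ε} 0<ε = search (proj₁ far) l Ll (U-up x
    (subst (_< l + fromℕ (proj₁ far) * ε) (q+[r-q]≡r l u) (+-monoʳ-< l (proj₂ far))) (proj₂ (U-inhabited x)))
    where
    l = proj₁ (L-inhabited x)
    Ll = proj₂ (L-inhabited x)
    u = proj₁ (U-inhabited x)
    far = archimedean (u - l) 0<ε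
    search : ∀ j l → L x l → U x (l + fromℕ j * ε) → ∃ λ q → L x q × U x (q + ε + ε)
    search zero    l Ll Ul = contradiction (subst (U x) (start l ε) Ul) (disjoint x Ll)
    search (suc j) l Ll Ul = [ onward , (λ U′ → l , Ll , U′) ]′ (located x (p<p+q (l + ε) 0<ε))
      where
      onward : L x (l + ε) → ∃ λ q → L x q × U x (q + ε + ε)
      onward L′ = search j (l + ε) L′
        (subst (U x) (trans (cong (λ s → l + s * ε) (fromℕ-suc j)) (next l (fromℕ j) ε)) Ul)

  module Limit {I : Set} (s : I → ℝ) (Late : ℕ → I → Set)
    (Late-weaken : ∀ {M N i} → M ℕ.≤ N → Late N i → Late M i) (late : ∀ M → ∃ (Late M))
    (cauchy : ∀ ε → 0ℚ < ε → ∃ λ M → ∀ {i j} → Late M i → Late M j → ∀ {q} → L (s i) (q + ε) → L (s j) q)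
    where

    -- The Cauchy condition is symmetric in i and j, so it passes to upper cuts; locatedness costs a
    -- second ε.
    cauchy-U : ∀ ε (0<ε : 0ℚ < ε) {i j} → let M = proj₁ (cauchy ε 0<ε) in
      Late M i → Late M j → ∀ {q} → U (s i) q → U (s j) (q + ε + ε)
    cauchy-U ε 0<ε {i} {j} li lj {q} Uq =
      [ (λ L′ → contradiction Uq (disjoint (s i) (proj₂ (cauchy ε 0<ε) lj li L′))) , (λ U′ → U′) ]′
      (located (s j) (p<p+q (q + ε) 0<ε))

    -- The margin ε makes the cuts open.
    Lower Upper : ℚ → Set
    Lower q = ∃ λ ε → 0ℚ < ε × ∃ λ M → ∀ {i} → Late M i → L (s i) (q + ε)
    Upper q = ∃ λ ε → 0ℚ < ε × ∃ λ M → ∀ {i} → Late M i → U (s i) (q - ε)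

    private
      0<1 : 0ℚ < 1ℚ
      0<1 = positive⁻¹ 1ℚ

      lower-inhabited : ∃ Lower
      lower-inhabited = p - 1ℚ - 1ℚ , 1ℚ , 0<1 , proj₁ c , λ {j} lj →
        subst (L (s j)) (p≡p-q+q (p - 1ℚ) 1ℚ)
          (proj₂ c (proj₂ (late _)) lj (subst (L (s i)) (p≡p-q+q p 1ℚ) (proj₂ (L-inhabited (s i)))))
        where
        c = cauchy 1ℚ 0<1
        i = proj₁ (late (proj₁ c))
        p = proj₁ (L-inhabited (s i))

      upper-inhabited : ∃ Upper
      upper-inhabited = p + 1ℚ + 1ℚ + 1ℚ , 1ℚ , 0<1 , proj₁ c , λ {j} lj →
        subst (U (s j)) (p≡p+q-q (p + 1ℚ + 1ℚ) 1ℚ) (cauchy-U 1ℚ 0<1 (proj₂ (late _)) lj (proj₂ (U-inhabited (s i))))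
        where
        c = cauchy 1ℚ 0<1
        i = proj₁ (late (proj₁ c))
        p = proj₁ (U-inhabited (s i))

      cuts-located : ∀ {p q} → p < q → Lower p ⊎ Upper q
      cuts-located {p} {q} p<q = [ (λ l → inj₁ (lower l)) , (λ u → inj₂ (upper u)) ]′ (located (s i) gap)
        where
        -- As q = p + 8 ε, one late term can be located between p + 2 ε and q - 3 ε. Passing to
        -- other terms costs ε for lower and 2 ε for upper cuts, which leaves the margin ε.
        ε = ⅛ * (q - p)
        0<ε : 0ℚ < ε
        0<ε = positive⁻¹ ⅛ *⁺ p<q⇒0<q-p p<q
        M = proj₁ (cauchy ε 0<ε)
        i = proj₁ (late M)
        li = proj₂ (late M)
        gap : p + ε + ε < q - ε - ε - ε
        gap = subst (p + ε + ε <_)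
          (trans (gap-eq p ε) (cong (λ z → z - ε - ε - ε) (trans (cong (λ z → p + z) (sym (8*⅛ (q - p)))) (q+[r-q]≡r p q))))
          (p<p+q (p + ε + ε) (<-trans 0<ε (<-trans (p<p+q ε 0<ε) (p<p+q (ε + ε) 0<ε))))
        lower : L (s i) (p + ε + ε) → Lower p
        lower l = ε , 0<ε , M , λ lj → proj₂ (cauchy ε 0<ε) li lj l
        upper : U (s i) (q - ε - ε - ε) → Upper q
        upper u = ε , 0<ε , M , λ {j} lj → subst (U (s j)) (-3ε+2ε q ε) (cauchy-U ε 0<ε li lj u)

    η : ℝ
    η = record
      { L = Lower
      ; U = Upper
      ; L-inhabited = lower-inhabited
      ; U-inhabited = upper-inhabited
      ; L-down = λ p<q (ε , 0<ε , M , l) → ε , 0<ε , M , λ {i} li → L-down (s i) (+-monoˡ-< ε p<q) (l li)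
      ; U-up = λ p<q (ε , 0<ε , M , u) → ε , 0<ε , M , λ {i} li → U-up (s i) (+-monoˡ-< (- ε) p<q) (u li)
      ; L-open = λ {p} (ε , 0<ε , M , l) → let 0<h = positive⁻¹ ½ *⁺ 0<ε in
          p + ½ * ε , p<p+q p 0<h , ½ * ε , 0<h , M , λ {i} li → subst (L (s i)) (p+ε≡halves p ε) (l li)
      ; U-open = λ {q} (ε , 0<ε , M , u) → let 0<h = positive⁻¹ ½ *⁺ 0<ε in
          q - ½ * ε , q-p<q q 0<h , ½ * ε , 0<h , M , λ {i} li → subst (U (s i)) (p-ε≡halves q ε) (u li)
      ; disjoint = λ {q} (ε , 0<ε , M , l) (δ , 0<δ , N , u) →
          let i , li = late (M ℕ.⊔ N) in
          disjoint (s i) (L-down (s i) (<-trans (q-p<q q 0<δ) (p<p+q q 0<ε)) (l (Late-weaken (ℕ.m≤m⊔n M N) li)))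
                         (u (Late-weaken (ℕ.m≤n⊔m M N) li))
      ; located = cuts-located
      }

    converges : ∀ ε → 0ℚ < ε → ∃ λ M → ∀ {i} → Late M i → Within ε (s i) η
    converges ε 0<ε = M , close
      where
      e = ⅛ * ε
      0<e : 0ℚ < e
      0<e = positive⁻¹ ⅛ *⁺ 0<ε
      M = proj₁ (cauchy e 0<e)
      0<3e : 0ℚ < e + e + e
      0<3e = <-trans 0<e (<-trans (p<p+q e 0<e) (p<p+q (e + e) 0<e))
      0<4e : 0ℚ < e + e + e + e
      0<4e = <-trans 0<3e (p<p+q (e + e + e) 0<e)

      close : ∀ {i} → Late M i → Within ε (s i) η
      -- The point q + 2 e lies above s i, and shifted down by ε = 8 e it lies below η. The point q
      -- + 5 e lies above η, and shifted down by ε it is q - 3 e, below s i.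
      close {i} li = (q + e + e , Uq , e , 0<e , M , λ {j} lj → L-down (s j) less (below lj)) ,
        (q + e + e + e + e + e ,
          (e , 0<e , M , λ {j} lj → subst (U (s j)) (p≡p+q-q (q + e + e + e + e) e) (cauchy-U e 0<e li lj Uq)) ,
          L-down (s i) less′ Lq)
        where
        a = approximate (s i) 0<e
        q = proj₁ a
        Lq = proj₁ (proj₂ a)
        Uq = proj₂ (proj₂ a)
        below : ∀ {j} → Late M j → L (s j) (q - e)
        below lj = proj₂ (cauchy e 0<e) li lj (subst (L (s i)) (p≡p-q+q q e) Lq)
        less : q + e + e - ε + e < q - e
        less = subst (_< q - e) (trans (lower-eq q e) (cong (λ z → q + e + e - z + e) (sym (8*⅛ ε)))) (q-p<q (q - e) 0<4e)
        less′ : q + e + e + e + e + e - ε < q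
        less′ = subst (_< q) (trans (upper-eq q e) (cong (λ z → q + e + e + e + e + e - z) (sym (8*⅛ ε)))) (q-p<q q 0<3e)

-- Existence of the limit.

open Growth using (f-cauchy; f≤2^order)
open Rates using (AtMost; AtLeast; f-atMost; f-atLeast)
open Rational
open Limits
open import Defs
open import Data.Integer.Base using (+_)
open import Data.Nat.Base as ℕ using (ℕ; suc)
import Data.Nat.Properties as ℕ
open import Data.Nat.Tactic.RingSolver using (solve-∀)
open import Data.Product using (∃; ∃₂; _×_; _,_; proj₁; proj₂)
open import Data.Rational.Base hiding (∣_∣)
open import Data.Rational.Properties
open import Data.Sum.Base using (_⊎_; inj₁; inj₂; [_,_]′)
open import Relation.Binary.PropositionalEquality
open import Relation.Nullary using (¬_; Dec; yes; no; contradiction)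
open ℝ

-- Turns the double limit into a limit over one index set.
record Index : Set where
  constructor index
  field
    m n  : ℕ
    .m≢0 : ℕ.NonZero m
    .n≢0 : ℕ.NonZero n

open Index

term : Index → ℝ
term (index m n m≢0 n≢0) = growth m n {{m≢0}} {{n≢0}}

N : Index → ℕ
N i = order (m i) (n i)

F : Index → ℚ
F i = fromℕ (f (m i) (n i))

.N≢0 : ∀ i → ℕ.NonZero (N i)
N≢0 (index m n m≢0 _) = order-nonZero m n {{m≢0}}

Late : ℕ → Index → Set
Late M i = M ℕ.≤ m i × M ℕ.≤ n i

index⁺ : ∀ {M m n} → suc M ℕ.≤ m → suc M ℕ.≤ n → Index
index⁺ {m = m} {n} p q = index m n (ℕ.>-nonZero (ℕ.≤-trans (ℕ.s≤s ℕ.z≤n) p)) (ℕ.>-nonZero (ℕ.≤-trans (ℕ.s≤s ℕ.z≤n) q))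

-- ρ = 1 + 1 / k satisfies 2 ≤ ρ ^ k, so f-cauchy gives F i ^ N j ≤ F j ^ N i * ρ ^ (N i * N j).
module _ (k : ℕ) .{{_ : ℕ.NonZero k}} (d : ℚ) (0<d : 0ℚ < d) (kd≡1 : fromℕ k * d ≡ 1ℚ) where

  private
    ρ = 1ℚ + d

    0≤ρ : 0ℚ ≤ ρ
    0≤ρ = ≤-trans 0≤1 (p≤p+q 1ℚ (<⇒≤ 0<d))

    2≤ρ^k : fromℕ 2 ≤ ρ ^ k
    2≤ρ^k = subst₂ _≤_
      (trans (cong₂ _*_ (cong (λ z → 1ℚ + z) kd≡1) (1^ k)) (*-identityʳ (1ℚ + 1ℚ))) (*-identityˡ (ρ ^ k))
      (bernoulli 1ℚ d 0≤1 (<⇒≤ 0<d) k)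

    F-cauchy : ∀ {i j} → Late (8 ℕ.* k) i → Late (8 ℕ.* k) j →
      F i ^ (N j ℕ.* k) ≤ F j ^ (N i ℕ.* k) * ρ ^ (k ℕ.* (N i ℕ.* N j))
    F-cauchy {i} {j} (a , b) (a′ , b′) = begin
      F i ^ (N j ℕ.* k)
        ≡⟨ fromℕ-^ (f (m i) (n i)) (N j ℕ.* k) ⟨
      fromℕ (f (m i) (n i) ℕ.^ (N j ℕ.* k))
        ≤⟨ fromℕ-mono (f-cauchy k (m i) (n i) (m j) (n j) (ℕ.>-nonZero⁻¹ k) a b a′ b′) ⟩
      fromℕ (f (m j) (n j) ℕ.^ (N i ℕ.* k) ℕ.* 2 ℕ.^ (N i ℕ.* N j))
        ≡⟨ trans (fromℕ-* (f (m j) (n j) ℕ.^ (N i ℕ.* k)) (2 ℕ.^ (N i ℕ.* N j)))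
             (cong₂ _*_ (fromℕ-^ (f (m j) (n j)) (N i ℕ.* k)) (fromℕ-^ 2 (N i ℕ.* N j))) ⟩
      F j ^ (N i ℕ.* k) * fromℕ 2 ^ (N i ℕ.* N j)
        ≤⟨ *-monoˡ _ (^-nonNeg (N i ℕ.* k) (0≤fromℕ (f (m j) (n j)))) (^-mono-≤ (N i ℕ.* N j) (0≤fromℕ 2) 2≤ρ^k) ⟩
      F j ^ (N i ℕ.* k) * (ρ ^ k) ^ (N i ℕ.* N j)
        ≡⟨ cong (F j ^ (N i ℕ.* k) *_) (^-assoc ρ k (N i ℕ.* N j)) ⟩
      F j ^ (N i ℕ.* k) * ρ ^ (k ℕ.* (N i ℕ.* N j)) ∎
      where open ≤-Reasoning

    -- Root-free form of `term i` ≤ ρ `term j`; both sides are compared after raising to the power N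
    -- j k, where `F-cauchy` applies.
    scale : ∀ {i j q} → Late (8 ℕ.* k) i → Late (8 ℕ.* k) j → 0ℚ ≤ q →
      F j ≤ q ^ N j → F i ≤ (q * ρ) ^ N i
    scale {i} {j} {q} li lj 0≤q le = ^-cancel-≤ (N j ℕ.* k) {{ℕ.m*n≢0 (N j) k {{N≢0 j}}}} (^-nonNeg (N i) (0≤q *⁰ 0≤ρ)) (begin
      F i ^ (N j ℕ.* k)
        ≤⟨ F-cauchy {i} {j} li lj ⟩
      F j ^ (N i ℕ.* k) * ρ ^ (k ℕ.* (N i ℕ.* N j))
        ≤⟨ *-monoʳ _ (^-nonNeg (k ℕ.* (N i ℕ.* N j)) 0≤ρ) (^-mono-≤ (N i ℕ.* k) (0≤fromℕ (f (m j) (n j))) le) ⟩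
      (q ^ N j) ^ (N i ℕ.* k) * ρ ^ (k ℕ.* (N i ℕ.* N j))
        ≡⟨ cong₂ _*_ (trans (^-assoc q (N j) (N i ℕ.* k)) (cong (q ^_) (lem₁ (N j) (N i) k)))
                     (cong (ρ ^_) (lem₂ k (N i) (N j))) ⟩
      q ^ (N i ℕ.* (N j ℕ.* k)) * ρ ^ (N i ℕ.* (N j ℕ.* k))
        ≡⟨ ^-distrib-* q ρ (N i ℕ.* (N j ℕ.* k)) ⟨
      (q * ρ) ^ (N i ℕ.* (N j ℕ.* k))
        ≡⟨ ^-assoc (q * ρ) (N i) (N j ℕ.* k) ⟨
      ((q * ρ) ^ N i) ^ (N j ℕ.* k) ∎)
      where
      open ≤-Reasoning
      lem₁ : ∀ a b c → a ℕ.* (b ℕ.* c) ≡ b ℕ.* (a ℕ.* c)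
      lem₁ = solve-∀
      lem₂ : ∀ c b a → c ℕ.* (b ℕ.* a) ≡ b ℕ.* (a ℕ.* c)
      lem₂ = solve-∀

  -- If q were outside the lower cut of `term j`, `scale` would bound `term i` by q ρ = q + q d. As
  -- f ≤ 2 ^ order forces q < 2, this is at most q + 2 d ≤ q + ε, a contradiction.
  close : ∀ {ε} → fromℕ 2 * d ≤ ε → ∀ {i j} → Late (8 ℕ.* k) i → Late (8 ℕ.* k) j →
    ∀ {q} → L (term i) (q + ε) → L (term j) q
  close {ε} 2d≤ε {i} {j} li lj {q} l = decide (q <? 0ℚ) (q ^ N j <? F j) l
    where
    0<ε : 0ℚ < ε
    0<ε = <-≤-trans (0<fromℕ 2 *⁺ 0<d) 2d≤ε

    ¬l : 0ℚ ≤ q → F j ≤ q ^ N j → ¬ (q + ε) ^ N i < F i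
    ¬l 0≤q le lt = <-irrefl refl (<-≤-trans lt (≤-trans (scale {i} {j} li lj 0≤q le) (^-mono-≤ (N i) (0≤q *⁰ 0≤ρ) (begin
      q * ρ              ≡⟨ trans (*-distribˡ-+ q 1ℚ d) (cong (_+ q * d) (*-identityʳ q)) ⟩
      q + q * d          ≤⟨ +-monoʳ-≤ q (≤-trans (*-monoʳ d (<⇒≤ 0<d) (<⇒≤ q<2)) 2d≤ε) ⟩
      q + ε              ∎))))
      where
      open ≤-Reasoning
      q<2 : q < fromℕ 2
      q<2 = <-trans (p<p+q q 0<ε) (^-cancel-< (N i) (0≤fromℕ 2) (<-≤-trans lt
        (subst (F i ≤_) (fromℕ-^ 2 (N i)) (fromℕ-mono (f≤2^order (m i) (n i))))))

    decide : Dec (q < 0ℚ) → Dec (q ^ N j < F j) → (q + ε < 0ℚ) ⊎ ((q + ε) ^ N i < F i) → (q < 0ℚ) ⊎ (q ^ N j < F j)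
    decide (yes q<0) _        _         = inj₁ q<0
    decide (no _)    (yes lt) _         = inj₂ lt
    decide (no q≮0)  (no _)   (inj₁ <0) = contradiction (<-trans (p<p+q q 0<ε) <0) q≮0
    decide (no q≮0)  (no q≮F) (inj₂ lt) = contradiction lt (¬l (≮⇒≥ q≮0) (≮⇒≥ q≮F))

cauchy : ∀ ε → 0ℚ < ε → ∃ λ M → ∀ {i j} → Late M i → Late M j → ∀ {q} → L (term i) (q + ε) → L (term j) q
cauchy ε 0<ε = 8 ℕ.* k , λ {i} {j} → close k d 0<d (*-inverseʳ (fromℕ k)) 2d≤ε {i} {j}
  where
  large = archimedean (fromℕ 2) 0<ε
  k = suc (proj₁ large)
  instance
    k>0 : Positive (fromℕ k)
    k>0 = positive (0<fromℕ k)
    k≢0 : NonZero (fromℕ k)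
    k≢0 = pos⇒nonZero (fromℕ k)
  d = 1/ fromℕ k
  0<d : 0ℚ < d
  0<d = positive⁻¹ d {{1/pos⇒pos (fromℕ k)}}
  2d≤ε : fromℕ 2 * d ≤ ε
  2d≤ε = begin
    fromℕ 2 * d           ≤⟨ *-monoʳ d (<⇒≤ 0<d) (≤-trans (<⇒≤ (proj₂ large))
                               (*-monoʳ ε (<⇒≤ 0<ε) (fromℕ-mono (ℕ.n≤1+n (proj₁ large))))) ⟩
    fromℕ k * ε * d       ≡⟨ trans (cong (_* d) (*-comm (fromℕ k) ε)) (*-assoc ε (fromℕ k) d) ⟩
    ε * (fromℕ k * d)     ≡⟨ trans (cong (ε *_) (*-inverseʳ (fromℕ k))) (*-identityʳ ε) ⟩
    ε                     ∎
    where open ≤-Reasoning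

Late-weaken : ∀ {M N i} → M ℕ.≤ N → Late N i → Late M i
Late-weaken M≤N (a , b) = ℕ.≤-trans M≤N a , ℕ.≤-trans M≤N b

late : ∀ M → ∃ (Late M)
late M = index (suc M) (suc M) _ _ , ℕ.n≤1+n M , ℕ.n≤1+n M

open Limit term Late (λ {M} {N} {i} → Late-weaken {M} {N} {i}) late cauchy

growth-limit : DoubleLimit growth η
growth-limit ε 0<ε = let M , w = converges ε 0<ε in
  M , λ m n {{m≢0}} {{n≢0}} M≤m M≤n → w {index m n m≢0 n≢0} (M≤m , M≤n)

-- Supplies the hypothesis of `outgrows-^` for the error factor C ^ (m + n); the term 2 m n alone
-- suffices.
order-large : ∀ {i m n} → i ℕ.≤ m → i ℕ.≤ n → i ℕ.* (m ℕ.+ n) ℕ.≤ order m n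
order-large {i} {m} {n} i≤m i≤n = ℕ.≤-trans
  (subst₂ ℕ._≤_ (sym (ℕ.*-distribˡ-+ i m n)) (lem m n) (ℕ.+-mono-≤ (ℕ.*-monoˡ-≤ m i≤n) (ℕ.*-monoˡ-≤ n i≤m)))
  (ℕ.≤-trans (ℕ.m≤m+n (2 ℕ.* m ℕ.* n) m) (ℕ.m≤m+n (2 ℕ.* m ℕ.* n ℕ.+ m) n))
  where
  lem : ∀ m n → n ℕ.* m ℕ.+ m ℕ.* n ≡ 2 ℕ.* m ℕ.* n
  lem = solve-∀

-- Transfer of the growth rates to the limit.

module _ (p q : ℕ) .{{_ : ℕ.NonZero p}} .{{_ : ℕ.NonZero q}} where

  private
    K Q : ℚ
    K = + p / q
    Q = fromℕ q

    0<Q^ : ∀ k → 0ℚ < Q ^ k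
    0<Q^ k = ^-pos k (0<fromℕ q)

    0<K : 0ℚ < K
    0<K = *-cancelʳ-<-nonNeg Q {{nonNegative (0≤fromℕ q)}}
      (subst₂ _<_ (sym (*-zeroˡ Q)) (sym (/-*-fromℕ p q)) (0<fromℕ p))

    K^*Q^ : ∀ k → fromℕ (p ℕ.^ k) ≡ K ^ k * Q ^ k
    K^*Q^ k = trans (fromℕ-^ p k) (trans (cong (_^ k) (sym (/-*-fromℕ p q))) (^-distrib-* K Q k))

    F*Q^ : ∀ i k → fromℕ (f (m i) (n i) ℕ.* q ℕ.^ k) ≡ F i * Q ^ k
    F*Q^ i k = trans (fromℕ-* (f (m i) (n i)) (q ℕ.^ k)) (cong (F i *_) (fromℕ-^ q k))

    clear : ∀ k {x y} → x * Q ^ k ≤ y * Q ^ k → x ≤ y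
    clear k = *-cancelʳ-≤-pos (Q ^ k) {{positive (0<Q^ k)}}

  -- If x ≥ K, the margin in the lower cut of η puts y = x + ε > K below all late terms, so yᴺ < f.
  -- But large rectangles from `AtMost` satisfy f ≤ Cᵉ Kᴺ ≤ yᴺ.
  atMost⇒η≤ : AtMost p q → η ≤ᵣ fromℚ (+ p / q)
  atMost⇒η≤ (C , at) x (ε , 0<ε , M , l) = decide (x <? K)
    where
    decide : Dec (x < K) → x < K
    decide (yes x<K) = x<K
    decide (no  x≮K) = contradiction (l {i} (ℕ.≤-trans M≤ (proj₁ big) , ℕ.≤-trans M≤ (proj₂ big)))
      [ (λ y<0 → <-asym y<0 0<y) , (λ lt → <-irrefl refl (<-≤-trans lt F≤)) ]′
      where
      y = x + ε
      K<y : K < y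
      K<y = ≤-<-trans (≮⇒≥ x≮K) (p<p+q x 0<ε)
      0<y : 0ℚ < y
      0<y = <-trans 0<K K<y
      g = outgrows C 0<K K<y
      B = M ℕ.⊔ proj₁ g
      -- `B` covers both thresholds, and the successor makes the sides positive, as `index⁺`
      -- requires.
      w = at (suc B)
      big : suc B ℕ.≤ proj₁ w × suc B ℕ.≤ proj₁ (proj₂ w)
      big = proj₁ (proj₂ (proj₂ w)) , proj₁ (proj₂ (proj₂ (proj₂ w)))
      i = index⁺ (proj₁ big) (proj₂ big)
      M≤ : M ℕ.≤ suc B
      M≤ = ℕ.m≤n⇒m≤1+n (ℕ.m≤m⊔n M (proj₁ g))
      g≤ : proj₁ g ℕ.≤ suc B
      g≤ = ℕ.m≤n⇒m≤1+n (ℕ.m≤n⊔m M (proj₁ g))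
      e = m i ℕ.+ n i
      F≤ : F i ≤ y ^ N i
      F≤ = ≤-trans (clear (N i) (begin
        F i * Q ^ N i
          ≡⟨ F*Q^ i (N i) ⟨
        fromℕ (f (m i) (n i) ℕ.* q ℕ.^ N i)
          ≤⟨ fromℕ-mono (proj₂ (proj₂ (proj₂ (proj₂ w)))) ⟩
        fromℕ (C ℕ.^ e ℕ.* p ℕ.^ N i)
          ≡⟨ trans (fromℕ-* (C ℕ.^ e) (p ℕ.^ N i)) (cong₂ _*_ (fromℕ-^ C e) (K^*Q^ (N i))) ⟩
        fromℕ C ^ e * (K ^ N i * Q ^ N i)
          ≡⟨ *-assoc (fromℕ C ^ e) (K ^ N i) (Q ^ N i) ⟨
        fromℕ C ^ e * K ^ N i * Q ^ N i ∎))
        (outgrows-^ C (proj₁ g) e (N i) (<⇒≤ 0<K) (<⇒≤ K<y) (proj₂ g)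
          (order-large (ℕ.≤-trans g≤ (proj₁ big)) (ℕ.≤-trans g≤ (proj₂ big))))
        where open ≤-Reasoning

  -- Locating η between x and some y < K leaves `U η y` to refute. It would give f < yᴺ for late
  -- rectangles, but with `D` the image of `suc C`, large ones from `AtLeast` satisfy Kᴺ ≤ Dᵉ f < Dᵉ
  -- yᴺ ≤ Kᴺ.
  atLeast⇒≤η : AtLeast p q → fromℚ (+ p / q) ≤ᵣ η
  atLeast⇒≤η (C , at) x x<K = [ (λ l → l) , (λ u → contradiction u ¬upper) ]′ (located η (proj₁ (proj₂ between)))
    where
    between : ∃ λ y → x < y × y < K
    between = <-dense x<K
    y = proj₁ between
    y<K = proj₂ (proj₂ between)
    ¬upper : ¬ U η y
    ¬upper (ε , 0<ε , M , u) = <-irrefl refl (begin-strict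
      K ^ N i
        ≤⟨ clear (N i) (begin
             K ^ N i * Q ^ N i
               ≡⟨ K^*Q^ (N i) ⟨
             fromℕ (p ℕ.^ N i)
               ≤⟨ fromℕ-mono (ℕ.≤-trans (proj₂ (proj₂ (proj₂ (proj₂ w))))
                    (ℕ.*-monoˡ-≤ _ (ℕ.^-monoˡ-≤ e (ℕ.n≤1+n C)))) ⟩
             fromℕ (suc C ℕ.^ e ℕ.* (f (m i) (n i) ℕ.* q ℕ.^ N i))
               ≡⟨ trans (fromℕ-* (suc C ℕ.^ e) _) (cong₂ _*_ (fromℕ-^ (suc C) e) (F*Q^ i (N i))) ⟩
             D ^ e * (F i * Q ^ N i)
               ≡⟨ *-assoc (D ^ e) (F i) (Q ^ N i) ⟨
             D ^ e * F i * Q ^ N i ∎) ⟩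
      D ^ e * F i
        <⟨ *-monoʳ-<-pos (D ^ e) {{positive (^-pos e (0<fromℕ (suc C)))}} F<y^ ⟩
      D ^ e * y ^ N i
        ≤⟨ outgrows-^ (suc C) (proj₁ g) e (N i) (<⇒≤ 0<y) (<⇒≤ y<K) (proj₂ g)
             (order-large (ℕ.≤-trans g≤ (proj₁ big)) (ℕ.≤-trans g≤ (proj₂ big))) ⟩
      K ^ N i ∎)
      where
      open ≤-Reasoning
      -- The successor makes the factor positive, which the strict step needs.
      D = fromℕ (suc C)
      late-U : ∀ {i} → Late M i → 0ℚ < y - ε × F i < (y - ε) ^ N i
      late-U {i} = u {i}
      y-ε<y : y - ε < y
      y-ε<y = subst (y - ε <_) (+-identityʳ y) (+-monoʳ-< y (neg-antimono-< 0<ε))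
      -- The upper cut of a root contains only positive rationals, so any late term yields 0 < y -
      -- ε.
      0<y : 0ℚ < y
      0<y = <-trans (proj₁ (late-U {proj₁ (late M)} (proj₂ (late M)))) y-ε<y
      g = outgrows (suc C) 0<y y<K
      B = M ℕ.⊔ proj₁ g
      w = at (suc B)
      big : suc B ℕ.≤ proj₁ w × suc B ℕ.≤ proj₁ (proj₂ w)
      big = proj₁ (proj₂ (proj₂ w)) , proj₁ (proj₂ (proj₂ (proj₂ w)))
      i = index⁺ (proj₁ big) (proj₂ big)
      M≤ : M ℕ.≤ suc B
      M≤ = ℕ.m≤n⇒m≤1+n (ℕ.m≤m⊔n M (proj₁ g))
      g≤ : proj₁ g ℕ.≤ suc B
      g≤ = ℕ.m≤n⇒m≤1+n (ℕ.m≤n⊔m M (proj₁ g))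
      e = m i ℕ.+ n i
      late-i : 0ℚ < y - ε × F i < (y - ε) ^ N i
      late-i = late-U {i} (ℕ.≤-trans M≤ (proj₁ big) , ℕ.≤-trans M≤ (proj₂ big))
      F<y^ : F i < y ^ N i
      F<y^ = <-≤-trans (proj₂ late-i) (^-mono-≤ (N i) (<⇒≤ (proj₁ late-i)) (<⇒≤ y-ε<y))

mainTheorem5 : ∃ λ (η : ℝ) →
    DoubleLimit growth η
    × fromℚ (+ 1503041110 / 1000000000) ≤ᵣ η
    × η ≤ᵣ fromℚ (+ 1503048372 / 1000000000)
mainTheorem5 = η , growth-limit , atLeast⇒≤η 1503041110 1000000000 f-atLeast , atMost⇒η≤ 1503048372 1000000000 f-atMost
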